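{- Let $1\le k\le n-1$ and let $w\in\mathfrak{S}_n$ be the permutation $(w(1),\dots,w(n))=(n-k+1,\dots,n,1,\dots,n-k)$, the maximal element of the set of minimal left coset representatives of $\mathfrak{S}_n$ modulo the parabolic subgroup generated by $\{s_1,\dots,s_{n-1}\}\setminus\{s_k\}$. Then the number of elements of the Bruhat interval $[\mathrm{id},w]$ is \[|[\mathrm{id},w]|=\sum_{i=0}^{k}S_{k+1,i+1}\,S_{n-k+1,i+1}\,(i!)^2=(-1)^k\sum_{i=0}^{k}(-1)^i(i+1)^{n-k}\,i!\,S_{k,i}=B_k^{(k-n)},\] where $S_{a,b}$ are the Stirling numbers of the second kind and $B_m^{(j)}$ are Kaneko's poly-Bernoulli numbers.
   Context: $s_i$ denotes the adjacent transposition $(i\ i{+}1)$ in $\mathfrak{S}_n$, and Bruhat order is the usual one. $S_{a,b}$ is the Stirling number of the second kind (with $S_{0,0}=1$, $S_{a,0}=0$ for $a>0$). For an integer $j$, the poly-Bernoulli numbers $B_m^{(j)}$ ($m\ge0$) of Kaneko are defined by $\sum_{m\ge0}B_m^{(j)}\frac{x^m}{m!}=\frac{\mathrm{Li}_j(1-e^{ -x})}{1-e^{ -x}}$, where $\mathrm{Li}_j(z)=\sum_{r\ge1}z^r/r^j$. -}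

module Defs where

open import Data.Nat as ℕ using (ℕ; zero; suc; _<_; _<ᵇ_; _∸_; _!; _^_)
open import Data.Nat.Properties using (_!≢0)
open import Data.Nat.DivMod using (_mod_)
open import Data.Integer as ℤ using (ℤ; +_; -[1+_])
open import Data.Rational as ℚ using (ℚ; 0ℚ; 1ℚ)
open import Data.Fin using (Fin; toℕ)
open import Data.Vec using (Vec; lookup; tabulate; _[_]≔_)
open import Data.List using (List; []; _∷_; length; map; cartesianProduct; foldr)
open import Data.List.Relation.Unary.Unique.Propositional using (Unique)
open import Data.List.Membership.Propositional using (_∈_)
open import Data.Bool using (Bool; true; false; if_then_else_; _∧_)
open import Data.Product using (Σ; _×_; _,_)
open import Function.Bundles using (_⇔_)
open import Relation.Binary.PropositionalEquality using (_≡_)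
open import Data.Vec using (allFin)
import Data.Vec as Vec

sumℕ : ℕ → (ℕ → ℕ) → ℕ
sumℕ zero    f = f 0
sumℕ (suc k) f = sumℕ k f ℕ.+ f (suc k)

sumℤ : ℕ → (ℕ → ℤ) → ℤ
sumℤ zero    f = f 0
sumℤ (suc k) f = sumℤ k f ℤ.+ f (suc k)

sumℚ : ℕ → (ℕ → ℚ) → ℚ
sumℚ zero    f = f 0
sumℚ (suc k) f = sumℚ k f ℚ.+ f (suc k)

sign : ℕ → ℤ
sign zero    = + 1
sign (suc i) = ℤ.- sign i

S : ℕ → ℕ → ℕ
S zero    zero    = 1
S zero    (suc b) = 0
S (suc a) zero    = 0
S (suc a) (suc b) = suc b ℕ.* S a (suc b) ℕ.+ S a b

-- Permutations of {0,…,n-1} in one-line notation, Bruhat order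

Word : ℕ → Set
Word n = Vec (Fin n) n

idP : (n : ℕ) → Word n
idP n = allFin n

-- the permutation (n-k+1,…,n,1,…,n-k) (written 0-based: p ↦ (p + n - k) mod n)
wmax : (n k : ℕ) → Word n
wmax zero    k = Vec.[]
wmax (suc m) k = tabulate (λ p → (toℕ p ℕ.+ (suc m ∸ k)) mod suc m)

-- number of inversions: pairs i < j with u(i) > u(j)  (= Coxeter length in S_n)
inv : {n : ℕ} → Word n → ℕ
inv {n} u = foldr ℕ._+_ 0 (map ind (cartesianProduct (Vec.toList (allFin n)) (Vec.toList (allFin n))))
  where
  ind : Fin n × Fin n → ℕ
  ind (i , j) = if (toℕ i <ᵇ toℕ j) ∧ (toℕ (lookup u j) <ᵇ toℕ (lookup u i)) then 1 else 0

-- right multiplication by the transposition (i j): swap the entries in positions i and j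
swapAt : {n : ℕ} → Fin n → Fin n → Word n → Word n
swapAt i j u = (u [ i ]≔ lookup u j) [ j ]≔ lookup u i

data _≤B_ {n : ℕ} : Word n → Word n → Set where
  ≤B-refl : {u : Word n} → u ≤B u
  ≤B-step : {u v : Word n} (i j : Fin n) →
            inv u < inv (swapAt i j u) → swapAt i j u ≤B v → u ≤B v

HasCard : {A : Set} → (A → Set) → ℕ → Set
HasCard {A} P N =
  Σ (List A) λ L → Unique L × ((v : A) → (v ∈ L) ⇔ P v) × length L ≡ N

Interval : {n : ℕ} → Word n → Word n → Word n → Set
Interval u w v = (u ≤B v) × (v ≤B w)

PS : Set
PS = ℕ → ℚ

ℚfromℕ : ℕ → ℚ
ℚfromℕ m = (+ m) ℚ./ 1

ℚfromℤ : ℤ → ℚ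
ℚfromℤ z = z ℚ./ 1

_*ₛ_ : PS → PS → PS
(f *ₛ g) m = sumℚ m (λ a → f a ℚ.* g (m ∸ a))

oneₛ : PS
oneₛ zero    = 1ℚ
oneₛ (suc m) = 0ℚ

_^ₛ_ : PS → ℕ → PS
f ^ₛ zero  = oneₛ
f ^ₛ suc p = (f ^ₛ p) *ₛ f

expNeg : PS
expNeg m = sign m ℚ./ (m !)
  where instance _ = m !≢0

zₛ : PS
zₛ m = oneₛ m ℚ.- expNeg m

-- 1/r for r ≥ 1 (value at 0 is irrelevant and never used)
recip : ℕ → ℚ
recip zero    = 0ℚ
recip (suc r) = (+ 1) ℚ./ suc r

powℚ : ℚ → ℕ → ℚ
powℚ q zero    = 1ℚ
powℚ q (suc e) = powℚ q e ℚ.* q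

invPow : ℤ → ℕ → ℚ
invPow (+ e)      r = powℚ (recip r) e
invPow -[1+ e ]   r = ℚfromℕ (r ^ suc e)

-- Li_j(z)/z = Σ_{r≥1} z^{r-1} / r^j, composed with z = 1 - e^{-x}.
-- Since z has no constant term, z^{r-1} = O(x^{r-1}), so the coefficient of x^m
-- only receives contributions from r = 1,…,m+1.
LiOverZ : ℤ → PS
LiOverZ j m = sumℚ m (λ q → invPow j (suc q) ℚ.* (zₛ ^ₛ q) m)

polyBernoulli : ℕ → ℤ → ℚ
polyBernoulli m j = ℚfromℕ (m !) ℚ.* LiOverZ j m

{-# OPTIONS --safe #-}

-- Write m = n − k.  A permutation lies below w in Bruhat order iff p − k ≤ v(p) ≤ p + m for all p
-- (p counted from 0): this band is closed under removing inversions, and a permutation in the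
-- band other than w admits a transposition that adds inversions and stays in the band.  The
-- number of such v is the permanent of a block matrix, with staircases on two opposite blocks
-- and all-one blocks elsewhere; a staircase of size k carries S(k+1,i+1) placements of k − i
-- rooks, and the rest is filled in i! · i! ways.  The alternating formula follows from
-- i! S(m+1,i+1) = Δⁱ (x+1)ᵐ (0), and the poly-Bernoulli one from the differential equation
-- (z^q)′ = q (z^(q−1) − z^q) of z = 1 − e^(−x).

module Submission where

open import Defs
open import Data.Nat using (ℕ; _≤_; _∸_; _+_; _*_; _^_; _!)
open import Data.Integer as ℤ using (ℤ; +_)
open import Data.Product using (_×_)
open import Relation.Binary.PropositionalEquality using (_≡_)
open import Data.Nat as ℕ using (zero; suc; _<_; _<ᵇ_; z≤n; s≤s; NonZero)
open import Data.Nat.DivMod using (_%_; _mod_; m<n⇒m%n≡m; [m+n]%n≡m%n)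
open import Data.Nat.Induction using (<-wellFounded)
open import Data.Nat.ListAction.Properties using (sum-++)
import Data.Nat.Properties as ℕ
import Data.Nat.Tactic.RingSolver as ℕSolver
open import Data.Integer using (-[1+_])
import Data.Integer.Properties as ℤ
open import Data.Integer.Tactic.RingSolver using (solve-∀)
open import Data.Rational as ℚ using (ℚ; 0ℚ; 1ℚ; fromℚᵘ)
import Data.Rational.Properties as ℚ
open import Data.Rational.Solver using (module +-*-Solver)
open import Data.Rational.Unnormalised as ℚᵘ using (mkℚᵘ; *≡*)
import Data.Rational.Unnormalised.Properties as ℚᵘ
open import Data.Bool using (true; false; if_then_else_; _∧_; T)
open import Data.Fin as Fin using (Fin; zero; suc; toℕ; fromℕ<; punchOut; _↑ˡ_; _↑ʳ_)
open import Data.Fin.Permutation using (transpose)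
import Data.Fin.Permutation.Components as PC
import Data.Fin.Properties as Fin
open import Data.List as List using (List; []; _∷_; _++_; replicate; applyUpTo; applyDownFrom; length; map; tabulate; allFin; cartesianProduct)
import Data.List.Properties as List
open import Data.List.Membership.Propositional using (_∈_)
import Data.List.Membership.Propositional.Properties as ∈
open import Data.List.Relation.Binary.Permutation.Propositional as Perm using (_↭_; ↭-sym; ↭-trans; ↭-reflexive)
import Data.List.Relation.Binary.Permutation.Propositional.Properties as ↭
open import Data.List.Relation.Binary.Pointwise as Pointwise using (Pointwise; []; _∷_)
open import Data.List.Relation.Unary.All as All using (All; []; _∷_)
import Data.List.Relation.Unary.All.Properties as All
open import Data.List.Relation.Unary.AllPairs using ([]; _∷_)
open import Data.List.Relation.Unary.Any using (here; there)
open import Data.List.Relation.Unary.Unique.Propositional using (Unique)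
import Data.List.Relation.Unary.Unique.Propositional.Properties as Unique
open import Data.Product using (Σ; ∃; ∃₂; _,_; proj₁; proj₂)
open import Data.Sum using (_⊎_; inj₁; inj₂)
open import Data.Unit using (tt)
open import Data.Vec as Vec using (Vec; []; _∷_; lookup)
import Data.Vec.Properties as Vec
open import Algebra.Properties.CommutativeMonoid.Sum ℕ.+-0-commutativeMonoid using (sum; sum-cong-≗; ∑-distrib-+; sum-permute)
open import Function using (_∘_; id; mk⇔; _⇔_; Equivalence)
open import Induction.WellFounded using (Acc; acc)
open import Relation.Binary.Definitions using (tri<; tri≈; tri>)
open import Relation.Binary.PropositionalEquality hiding (_≡_)
open import Relation.Nullary using (Dec; yes; no; ¬_; does; contradiction; _×-dec_; _→-dec_)
open import Relation.Nullary.Decidable using (dec-true)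
open ≡-Reasoning
open +-*-Solver using (solve; _:+_; _:*_; _:-_; :-_; _:=_; con)

-- Rook placements are never enumerated. The permanent is taken over lists of symbolic rows and
-- columns, so that removing the corner of a staircase is a relabelling: the corner row and column
-- lose their staircase structure, and multilinearity in a single line does the rest. The index `i`
-- of the Stirling sum is the number of rows deferred on the way. The coefficients produced by this
-- elimination and those of the alternating formula obey one summation rule, `Σ-S-suc-suc`.
--
-- On the Bruhat side, `≤B` admits every transposition that raises `inv`, not only covers. Hence no
-- exact change of length is ever computed: it is enough that exchanging an ascent raises `inv`
-- strictly. Since `≤B` relates arbitrary words, distinctness of the entries has to be carried
-- along.

-- Integer sums and the Stirling recurrence

sumℤ-cong : ∀ k {f g : ℕ → ℤ} → (∀ i → f i ≡ g i) → sumℤ k f ≡ sumℤ k g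
sumℤ-cong zero    eq = eq 0
sumℤ-cong (suc k) eq = cong₂ ℤ._+_ (sumℤ-cong k eq) (eq (suc k))

sumℤ-+ : ∀ k (f g : ℕ → ℤ) → sumℤ k (λ i → f i ℤ.+ g i) ≡ sumℤ k f ℤ.+ sumℤ k g
sumℤ-+ zero    f g = refl
sumℤ-+ (suc k) f g = begin
  sumℤ k (λ i → f i ℤ.+ g i) ℤ.+ (f (suc k) ℤ.+ g (suc k))
    ≡⟨ cong (ℤ._+ (f (suc k) ℤ.+ g (suc k))) (sumℤ-+ k f g) ⟩
  sumℤ k f ℤ.+ sumℤ k g ℤ.+ (f (suc k) ℤ.+ g (suc k))
    ≡⟨ exchange (sumℤ k f) (sumℤ k g) (f (suc k)) (g (suc k)) ⟩
  sumℤ k f ℤ.+ f (suc k) ℤ.+ (sumℤ k g ℤ.+ g (suc k)) ∎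
  where
  exchange : ∀ a b c d → a ℤ.+ b ℤ.+ (c ℤ.+ d) ≡ a ℤ.+ c ℤ.+ (b ℤ.+ d)
  exchange = solve-∀

sumℤ-*ˡ : ∀ k c (f : ℕ → ℤ) → sumℤ k (λ i → c ℤ.* f i) ≡ c ℤ.* sumℤ k f
sumℤ-*ˡ zero    c f = refl
sumℤ-*ˡ (suc k) c f = trans (cong (ℤ._+ (c ℤ.* f (suc k))) (sumℤ-*ˡ k c f)) (sym (ℤ.*-distribˡ-+ c (sumℤ k f) (f (suc k))))

sumℤ-shift : ∀ k (f : ℕ → ℤ) → sumℤ (suc k) f ≡ f 0 ℤ.+ sumℤ k (λ i → f (suc i))
sumℤ-shift zero    f = refl
sumℤ-shift (suc k) f = trans (cong (ℤ._+ f (suc (suc k))) (sumℤ-shift k f))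
                             (ℤ.+-assoc (f 0) (sumℤ k (λ i → f (suc i))) (f (suc (suc k))))

pos-sumℕ : ∀ k (f : ℕ → ℕ) → + sumℕ k f ≡ sumℤ k (λ i → + f i)
pos-sumℕ zero    f = refl
pos-sumℕ (suc k) f = trans (ℤ.pos-+ (sumℕ k f) (f (suc k))) (cong (ℤ._+ + f (suc k)) (pos-sumℕ k f))

S-vanishes : ∀ {a b} → a < b → S a b ≡ 0
S-vanishes {zero}  {suc b} _         = refl
S-vanishes {suc a} {suc b} (s≤s a<b)
  rewrite S-vanishes (ℕ.m<n⇒m<1+n a<b) | S-vanishes a<b | ℕ.*-zeroʳ b = refl

S-suc : ∀ a b → + S (suc a) (suc b) ≡ + suc b ℤ.* + S a (suc b) ℤ.+ + S a b
S-suc a b = trans (ℤ.pos-+ (suc b * S a (suc b)) (S a b))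
                  (cong (ℤ._+ + S a b) (ℤ.pos-* (suc b) (S a (suc b))))

-- The recurrence of S(k,·), transposed to act on the summed sequence.
Σ-S-suc : ∀ k (g : ℕ → ℤ) →
  sumℤ (suc k) (λ b → + S (suc k) b ℤ.* g b)
    ≡ sumℤ k (λ b → + S k b ℤ.* (+ b ℤ.* g b ℤ.+ g (suc b)))
Σ-S-suc k g = begin
  sumℤ (suc k) (λ b → + S (suc k) b ℤ.* g b)
    ≡⟨ sumℤ-shift k _ ⟩
  + 0 ℤ.* g 0 ℤ.+ sumℤ k (λ b → + S (suc k) (suc b) ℤ.* g (suc b))
    ≡⟨ cong (ℤ._+_ (+ 0 ℤ.* g 0)) (trans (sumℤ-cong k split) (sumℤ-+ k _ _)) ⟩
  + 0 ℤ.* g 0 ℤ.+ (sumℤ k (λ b → h (suc b)) ℤ.+ sumℤ k (λ b → + S k b ℤ.* g (suc b)))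
    ≡⟨ ℤ.+-assoc (+ 0 ℤ.* g 0) (sumℤ k (λ b → h (suc b))) _ ⟨
  + 0 ℤ.* g 0 ℤ.+ sumℤ k (λ b → h (suc b)) ℤ.+ sumℤ k (λ b → + S k b ℤ.* g (suc b))
    -- The range of `h` is padded at both ends at no cost: `h 0` vanishes through its factor `+ 0`,
    -- and `h (suc k)` because `S k (suc k)` is zero.
    ≡⟨ cong (λ z → z ℤ.+ sumℤ k (λ b → h (suc b)) ℤ.+ sumℤ k (λ b → + S k b ℤ.* g (suc b))) (zero-term (+ S k 0) (g 0)) ⟩
  h 0 ℤ.+ sumℤ k (λ b → h (suc b)) ℤ.+ sumℤ k (λ b → + S k b ℤ.* g (suc b))
    ≡⟨ cong (ℤ._+ sumℤ k (λ b → + S k b ℤ.* g (suc b))) (sumℤ-shift k h) ⟨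
  sumℤ k h ℤ.+ h (suc k) ℤ.+ sumℤ k (λ b → + S k b ℤ.* g (suc b))
    ≡⟨ cong (λ z → sumℤ k h ℤ.+ z ℤ.+ sumℤ k (λ b → + S k b ℤ.* g (suc b))) last-term ⟩
  sumℤ k h ℤ.+ + 0 ℤ.+ sumℤ k (λ b → + S k b ℤ.* g (suc b))
    ≡⟨ cong (ℤ._+ sumℤ k (λ b → + S k b ℤ.* g (suc b))) (ℤ.+-identityʳ (sumℤ k h)) ⟩
  sumℤ k h ℤ.+ sumℤ k (λ b → + S k b ℤ.* g (suc b))
    ≡⟨ sumℤ-+ k _ _ ⟨
  sumℤ k (λ b → h b ℤ.+ + S k b ℤ.* g (suc b))
    ≡⟨ sumℤ-cong k (λ b → ℤ.*-distribˡ-+ (+ S k b) (+ b ℤ.* g b) (g (suc b))) ⟨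
  sumℤ k (λ b → + S k b ℤ.* (+ b ℤ.* g b ℤ.+ g (suc b))) ∎
  where
  h : ℕ → ℤ
  h b = + S k b ℤ.* (+ b ℤ.* g b)

  expand : ∀ b s t x → (b ℤ.* s ℤ.+ t) ℤ.* x ≡ s ℤ.* (b ℤ.* x) ℤ.+ t ℤ.* x
  expand = solve-∀

  split : ∀ b → + S (suc k) (suc b) ℤ.* g (suc b) ≡ h (suc b) ℤ.+ + S k b ℤ.* g (suc b)
  split b = trans (cong (ℤ._* g (suc b)) (S-suc k b))
                  (expand (+ suc b) (+ S k (suc b)) (+ S k b) (g (suc b)))

  zero-term : ∀ s x → + 0 ℤ.* x ≡ s ℤ.* (+ 0 ℤ.* x)
  zero-term = solve-∀

  last-term : h (suc k) ≡ + 0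
  last-term rewrite S-vanishes (ℕ.n<1+n k) = refl

-- This is `Σ-S-suc` at `suc k` for the sequence `h` prefixed by a zero. The terms of index 0 drop
-- out on both sides because `S (suc a) 0` is zero.
Σ-S-suc-suc : ∀ k (h : ℕ → ℤ) →
  sumℤ (suc k) (λ i → + S (suc (suc k)) (suc i) ℤ.* h i)
    ≡ sumℤ k (λ i → + S (suc k) (suc i) ℤ.* (+ suc i ℤ.* h i ℤ.+ h (suc i)))
Σ-S-suc-suc k h = begin
  sumℤ (suc k) (λ i → + S (suc (suc k)) (suc i) ℤ.* h i)
    ≡⟨ drop-zero (sumℤ (suc k) (λ i → + S (suc (suc k)) (suc i) ℤ.* h i)) ⟩
  + 0 ℤ.* + 0 ℤ.+ sumℤ (suc k) (λ i → + S (suc (suc k)) (suc i) ℤ.* h i)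
    ≡⟨ sumℤ-shift (suc k) (λ b → + S (suc (suc k)) b ℤ.* g b) ⟨
  sumℤ (suc (suc k)) (λ b → + S (suc (suc k)) b ℤ.* g b)
    ≡⟨ Σ-S-suc (suc k) g ⟩
  sumℤ (suc k) (λ b → + S (suc k) b ℤ.* (+ b ℤ.* g b ℤ.+ g (suc b)))
    ≡⟨ sumℤ-shift k _ ⟩
  + 0 ℤ.* (+ 0 ℤ.+ h 0) ℤ.+ sumℤ k (λ i → + S (suc k) (suc i) ℤ.* (+ suc i ℤ.* h i ℤ.+ h (suc i)))
    ≡⟨ drop-zero′ (+ 0 ℤ.+ h 0) _ ⟩
  sumℤ k (λ i → + S (suc k) (suc i) ℤ.* (+ suc i ℤ.* h i ℤ.+ h (suc i))) ∎
  where
  g : ℕ → ℤ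
  g zero    = + 0
  g (suc i) = h i

  drop-zero : ∀ x → x ≡ + 0 ℤ.* + 0 ℤ.+ x
  drop-zero = solve-∀

  drop-zero′ : ∀ y x → + 0 ℤ.* y ℤ.+ x ≡ x
  drop-zero′ = solve-∀

-- Finite differences

diff : ℕ → (ℕ → ℤ) → ℕ → ℤ
diff zero    f x = f x
diff (suc i) f x = diff i f (suc x) ℤ.- diff i f x

diff-cong : ∀ i {f g : ℕ → ℤ} → (∀ x → f x ≡ g x) → ∀ x → diff i f x ≡ diff i g x
diff-cong zero    eq x = eq x
diff-cong (suc i) eq x = cong₂ ℤ._-_ (diff-cong i eq (suc x)) (diff-cong i eq x)

diff-diff₁ : ∀ i f x → diff i (diff 1 f) x ≡ diff (suc i) f x
diff-diff₁ zero    f x = refl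
diff-diff₁ (suc i) f x = cong₂ ℤ._-_ (diff-diff₁ i f (suc x)) (diff-diff₁ i f x)

diff-+ : ∀ i f g x → diff i (λ y → f y ℤ.+ g y) x ≡ diff i f x ℤ.+ diff i g x
diff-+ zero    f g x = refl
diff-+ (suc i) f g x = trans (cong₂ ℤ._-_ (diff-+ i f g (suc x)) (diff-+ i f g x))
  (exchange (diff i f (suc x)) (diff i g (suc x)) (diff i f x) (diff i g x))
  where
  exchange : ∀ a b c d → a ℤ.+ b ℤ.- (c ℤ.+ d) ≡ a ℤ.- c ℤ.+ (b ℤ.- d)
  exchange = solve-∀

x* : (ℕ → ℤ) → ℕ → ℤ
x* f x = + x ℤ.* f x

pos-suc : ∀ x → + suc x ≡ + 1 ℤ.+ + x
pos-suc x = ℤ.pos-+ 1 x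

-- Leibniz rule for the product of the identity and `f`. It is used at `x = 0`, where only the
-- second summand survives.
diff-x* : ∀ i f x → diff (suc i) (x* f) x ≡ + x ℤ.* diff (suc i) f x ℤ.+ + suc i ℤ.* diff i f (suc x)
diff-x* zero f x = trans (cong (λ z → z ℤ.* f (suc x) ℤ.- + x ℤ.* f x) (pos-suc x))
                         (identity (+ x) (f (suc x)) (f x))
  where
  identity : ∀ x a b → (+ 1 ℤ.+ x) ℤ.* a ℤ.- x ℤ.* b ≡ x ℤ.* (a ℤ.- b) ℤ.+ + 1 ℤ.* a
  identity = solve-∀
diff-x* (suc i) f x = begin
  diff (suc i) (x* f) (suc x) ℤ.- diff (suc i) (x* f) x
    ≡⟨ cong₂ ℤ._-_ (diff-x* i f (suc x)) (diff-x* i f x) ⟩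
  (+ suc x ℤ.* (c ℤ.- b) ℤ.+ + suc i ℤ.* c) ℤ.- (+ x ℤ.* (b ℤ.- a) ℤ.+ + suc i ℤ.* b)
    ≡⟨ cong (λ z → (z ℤ.* (c ℤ.- b) ℤ.+ + suc i ℤ.* c) ℤ.- (+ x ℤ.* (b ℤ.- a) ℤ.+ + suc i ℤ.* b)) (pos-suc x) ⟩
  ((+ 1 ℤ.+ + x) ℤ.* (c ℤ.- b) ℤ.+ + suc i ℤ.* c) ℤ.- (+ x ℤ.* (b ℤ.- a) ℤ.+ + suc i ℤ.* b)
    ≡⟨ identity (+ x) (+ suc i) a b c ⟩
  + x ℤ.* (c ℤ.- b ℤ.- (b ℤ.- a)) ℤ.+ (+ 1 ℤ.+ + suc i) ℤ.* (c ℤ.- b)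
    ≡⟨ cong (λ z → + x ℤ.* (c ℤ.- b ℤ.- (b ℤ.- a)) ℤ.+ z ℤ.* (c ℤ.- b)) (pos-suc (suc i)) ⟨
  + x ℤ.* (c ℤ.- b ℤ.- (b ℤ.- a)) ℤ.+ + suc (suc i) ℤ.* (c ℤ.- b) ∎
  where
  a b c : ℤ
  a = diff i f x
  b = diff i f (suc x)
  c = diff i f (suc (suc x))
  identity : ∀ x s a b c →
    ((+ 1 ℤ.+ x) ℤ.* (c ℤ.- b) ℤ.+ s ℤ.* c) ℤ.- (x ℤ.* (b ℤ.- a) ℤ.+ s ℤ.* b)
      ≡ x ℤ.* (c ℤ.- b ℤ.- (b ℤ.- a)) ℤ.+ (+ 1 ℤ.+ s) ℤ.* (c ℤ.- b)
  identity = solve-∀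

pos-! : ∀ i → + (suc i !) ≡ + suc i ℤ.* + (i !)
pos-! i = ℤ.pos-* (suc i) (i !)

-- Both sides are linear in f and obey the same recurrence in k, with f replaced by Δ (x f).
Σ-S-diff : ∀ k (f : ℕ → ℤ) →
  sumℤ k (λ i → + S (suc k) (suc i) ℤ.* (+ (i !) ℤ.* diff i f 0))
    ≡ sumℤ k (λ i → + S k i ℤ.* (sign k ℤ.* sign i ℤ.* + (i !) ℤ.* f i))
Σ-S-diff zero    f = identity (f 0)
  where
  identity : ∀ y → + 1 ℤ.* (+ 1 ℤ.* y) ≡ + 1 ℤ.* (+ 1 ℤ.* + 1 ℤ.* + 1 ℤ.* y)
  identity = solve-∀
Σ-S-diff (suc k) f = begin
  sumℤ (suc k) (λ i → + S (suc (suc k)) (suc i) ℤ.* (+ (i !) ℤ.* diff i f 0))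
    ≡⟨ Σ-S-suc-suc k _ ⟩
  sumℤ k (λ i → + S (suc k) (suc i) ℤ.* (+ suc i ℤ.* (+ (i !) ℤ.* diff i f 0) ℤ.+ + (suc i !) ℤ.* diff (suc i) f 0))
    ≡⟨ sumℤ-cong k (λ i → cong (+ S (suc k) (suc i) ℤ.*_) (left i)) ⟩
  sumℤ k (λ i → + S (suc k) (suc i) ℤ.* (+ (i !) ℤ.* diff i g 0))
    ≡⟨ Σ-S-diff k g ⟩
  sumℤ k (λ i → + S k i ℤ.* (sign k ℤ.* sign i ℤ.* + (i !) ℤ.* g i))
    ≡⟨ sumℤ-cong k (λ i → cong (+ S k i ℤ.*_) (right i)) ⟩
  sumℤ k (λ i → + S k i ℤ.* (+ i ℤ.* (sign (suc k) ℤ.* sign i ℤ.* + (i !) ℤ.* f i) ℤ.+ sign (suc k) ℤ.* sign (suc i) ℤ.* + (suc i !) ℤ.* f (suc i)))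
    ≡⟨ Σ-S-suc k _ ⟨
  sumℤ (suc k) (λ i → + S (suc k) i ℤ.* (sign (suc k) ℤ.* sign i ℤ.* + (i !) ℤ.* f i)) ∎
  where
  g : ℕ → ℤ
  g = diff 1 (x* f)

  left : ∀ i → + suc i ℤ.* (+ (i !) ℤ.* diff i f 0) ℤ.+ + (suc i !) ℤ.* diff (suc i) f 0 ≡ + (i !) ℤ.* diff i g 0
  left i = begin
    + suc i ℤ.* (+ (i !) ℤ.* diff i f 0) ℤ.+ + (suc i !) ℤ.* (diff i f 1 ℤ.- diff i f 0)
      ≡⟨ cong (λ z → + suc i ℤ.* (+ (i !) ℤ.* diff i f 0) ℤ.+ z ℤ.* (diff i f 1 ℤ.- diff i f 0)) (pos-! i) ⟩
    + suc i ℤ.* (+ (i !) ℤ.* diff i f 0) ℤ.+ + suc i ℤ.* + (i !) ℤ.* (diff i f 1 ℤ.- diff i f 0)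
      ≡⟨ identity (+ suc i) (+ (i !)) (diff i f 0) (diff i f 1) ⟩
    + (i !) ℤ.* (+ 0 ℤ.* (diff i f 1 ℤ.- diff i f 0) ℤ.+ + suc i ℤ.* diff i f 1)
      ≡⟨ cong (+ (i !) ℤ.*_) (trans (diff-diff₁ i (x* f) 0) (diff-x* i f 0)) ⟨
    + (i !) ℤ.* diff i g 0 ∎
    where
    identity : ∀ s p a b → s ℤ.* (p ℤ.* a) ℤ.+ s ℤ.* p ℤ.* (b ℤ.- a) ≡ p ℤ.* (+ 0 ℤ.* (b ℤ.- a) ℤ.+ s ℤ.* b)
    identity = solve-∀

  right : ∀ i → sign k ℤ.* sign i ℤ.* + (i !) ℤ.* g i ≡
    + i ℤ.* (sign (suc k) ℤ.* sign i ℤ.* + (i !) ℤ.* f i) ℤ.+ sign (suc k) ℤ.* sign (suc i) ℤ.* + (suc i !) ℤ.* f (suc i)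
  right i = trans
    (identity (sign k) (sign i) (+ (i !)) (+ suc i) (+ i) (f i) (f (suc i)))
    (cong (λ z → + i ℤ.* (sign (suc k) ℤ.* sign i ℤ.* + (i !) ℤ.* f i) ℤ.+ sign (suc k) ℤ.* sign (suc i) ℤ.* z ℤ.* f (suc i)) (sym (pos-! i)))
    where
    identity : ∀ s t p j i a b → s ℤ.* t ℤ.* p ℤ.* (j ℤ.* b ℤ.- i ℤ.* a) ≡
      i ℤ.* ((ℤ.- s) ℤ.* t ℤ.* p ℤ.* a) ℤ.+ (ℤ.- s) ℤ.* (ℤ.- t) ℤ.* (j ℤ.* p) ℤ.* b
    identity = solve-∀

-- Write (x+1)^(m+1) as x (x+1)^m + (x+1)^m. By `diff-x*` at 0, the differences of the two summands
-- combine to the recurrence of the Stirling numbers, scaled by factorials.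
diff-pow : ∀ m i → diff i (λ x → + (suc x ^ m)) 0 ≡ + (i ! * S (suc m) (suc i))
diff-pow zero zero    = refl
diff-pow zero (suc i) = trans (const i 0) (sym (cong +_ (trans (cong (suc i ! *_) (S-vanishes {1} {suc (suc i)} (s≤s (s≤s z≤n)))) (ℕ.*-zeroʳ (suc i !)))))
  where
  const : ∀ i x → diff (suc i) (λ _ → + 1) x ≡ + 0
  const zero    x = refl
  const (suc i) x = cong₂ ℤ._-_ (const i (suc x)) (const i x)
diff-pow (suc m) i = begin
  diff i (λ x → + (suc x ^ suc m)) 0
    ≡⟨ diff-cong i expand 0 ⟩
  diff i (λ x → x* p x ℤ.+ p x) 0
    ≡⟨ diff-+ i (x* p) p 0 ⟩
  diff i (x* p) 0 ℤ.+ diff i p 0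
    ≡⟨ step i ⟩
  + (i ! * S (suc (suc m)) (suc i)) ∎
  where
  p : ℕ → ℤ
  p x = + (suc x ^ m)

  expand : ∀ x → + (suc x ^ suc m) ≡ x* p x ℤ.+ p x
  expand x = trans (ℤ.pos-+ (suc x ^ m) (x * suc x ^ m))
    (trans (ℤ.+-comm (p x) (+ (x * suc x ^ m))) (cong (ℤ._+ p x) (ℤ.pos-* x (suc x ^ m))))

  step : ∀ i → diff i (x* p) 0 ℤ.+ diff i p 0 ≡ + (i ! * S (suc (suc m)) (suc i))
  step zero = begin
    + 0 ℤ.* p 0 ℤ.+ p 0 ≡⟨ cong (λ z → + 0 ℤ.* p 0 ℤ.+ z) (diff-pow m 0) ⟩
    + (1 * S (suc m) 1) ≡⟨ cong +_ (cong (1 *_) (sym (trans (ℕ.+-identityʳ _) (ℕ.*-identityˡ _)))) ⟩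
    + (1 * (1 * S (suc m) 1 + 0)) ∎
  step (suc i) = begin
    diff (suc i) (x* p) 0 ℤ.+ diff (suc i) p 0
      ≡⟨ cong (ℤ._+ diff (suc i) p 0) (diff-x* i p 0) ⟩
    + 0 ℤ.* diff (suc i) p 0 ℤ.+ + suc i ℤ.* diff i p 1 ℤ.+ diff (suc i) p 0
      ≡⟨ identity (+ suc i) (diff i p 1) (diff i p 0) ⟩
    (+ 1 ℤ.+ + suc i) ℤ.* diff (suc i) p 0 ℤ.+ + suc i ℤ.* diff i p 0
      ≡⟨ cong₂ (λ y z → (+ 1 ℤ.+ + suc i) ℤ.* y ℤ.+ + suc i ℤ.* z) (diff-pow m (suc i)) (diff-pow m i) ⟩
    (+ 1 ℤ.+ + suc i) ℤ.* + (suc i ! * s) ℤ.+ + suc i ℤ.* + (i ! * t)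
      ≡⟨ cong₂ (λ y z → (+ 1 ℤ.+ + suc i) ℤ.* y ℤ.+ + suc i ℤ.* z)
           (trans (ℤ.pos-* (suc i !) s) (cong (ℤ._* + s) (pos-! i))) (ℤ.pos-* (i !) t) ⟩
    (+ 1 ℤ.+ + suc i) ℤ.* (+ suc i ℤ.* + (i !) ℤ.* + s) ℤ.+ + suc i ℤ.* (+ (i !) ℤ.* + t)
      ≡⟨ identity₂ (+ suc i) (+ (i !)) (+ s) (+ t) ⟩
    + suc i ℤ.* + (i !) ℤ.* ((+ 1 ℤ.+ + suc i) ℤ.* + s ℤ.+ + t)
      ≡⟨ cong₂ ℤ._*_ (pos-! i) (S-suc (suc m) (suc i)) ⟨
    + (suc i !) ℤ.* + S (suc (suc m)) (suc (suc i))
      ≡⟨ ℤ.pos-* (suc i !) _ ⟨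
    + (suc i ! * S (suc (suc m)) (suc (suc i))) ∎
    where
    s = S (suc m) (suc (suc i))
    t = S (suc m) (suc i)
    identity : ∀ j b a → + 0 ℤ.* (b ℤ.- a) ℤ.+ j ℤ.* b ℤ.+ (b ℤ.- a) ≡ (+ 1 ℤ.+ j) ℤ.* (b ℤ.- a) ℤ.+ j ℤ.* a
    identity = solve-∀
    identity₂ : ∀ j p s t → (+ 1 ℤ.+ j) ℤ.* (j ℤ.* p ℤ.* s) ℤ.+ j ℤ.* (p ℤ.* t) ≡ j ℤ.* p ℤ.* ((+ 1 ℤ.+ j) ℤ.* s ℤ.+ t)
    identity₂ = solve-∀

-- The Stirling sum and its alternating form

stirlingSum : ℕ → ℕ → ℕ
stirlingSum k m = sumℕ k (λ i → S (k + 1) (i + 1) * S (m + 1) (i + 1) * (i ! * i !))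

pos-stirlingSum : ∀ k m → + stirlingSum k m ≡
  sumℤ k (λ i → + S (suc k) (suc i) ℤ.* + (S (suc m) (suc i) * (i ! * i !)))
pos-stirlingSum k m = trans (pos-sumℕ k _) (sumℤ-cong k term)
  where
  term : ∀ i → + (S (k + 1) (i + 1) * S (m + 1) (i + 1) * (i ! * i !)) ≡
    + S (suc k) (suc i) ℤ.* + (S (suc m) (suc i) * (i ! * i !))
  term i rewrite ℕ.+-comm k 1 | ℕ.+-comm m 1 | ℕ.+-comm i 1 =
    trans (cong +_ (ℕ.*-assoc (S (suc k) (suc i)) (S (suc m) (suc i)) (i ! * i !)))
          (ℤ.pos-* (S (suc k) (suc i)) _)

stirlingSum-alternating : ∀ k m → + stirlingSum k m ≡
  sign k ℤ.* sumℤ k (λ i → sign i ℤ.* + ((i + 1) ^ m * i ! * S k i))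
stirlingSum-alternating k m = begin
  + stirlingSum k m
    ≡⟨ pos-stirlingSum k m ⟩
  sumℤ k (λ i → + S (suc k) (suc i) ℤ.* + (S (suc m) (suc i) * (i ! * i !)))
    ≡⟨ sumℤ-cong k (λ i → cong (+ S (suc k) (suc i) ℤ.*_) (factor i)) ⟩
  sumℤ k (λ i → + S (suc k) (suc i) ℤ.* (+ (i !) ℤ.* diff i p 0))
    ≡⟨ Σ-S-diff k p ⟩
  sumℤ k (λ i → + S k i ℤ.* (sign k ℤ.* sign i ℤ.* + (i !) ℤ.* p i))
    ≡⟨ sumℤ-cong k collect ⟩
  sumℤ k (λ i → sign k ℤ.* (sign i ℤ.* + ((i + 1) ^ m * i ! * S k i)))
    ≡⟨ sumℤ-*ˡ k (sign k) _ ⟩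
  sign k ℤ.* sumℤ k (λ i → sign i ℤ.* + ((i + 1) ^ m * i ! * S k i)) ∎
  where
  p : ℕ → ℤ
  p x = + (suc x ^ m)

  factor : ∀ i → + (S (suc m) (suc i) * (i ! * i !)) ≡ + (i !) ℤ.* diff i p 0
  factor i = begin
    + (S (suc m) (suc i) * (i ! * i !))
      ≡⟨ cong +_ (trans (ℕ.*-comm (S (suc m) (suc i)) (i ! * i !)) (ℕ.*-assoc (i !) (i !) _)) ⟩
    + (i ! * (i ! * S (suc m) (suc i)))
      ≡⟨ ℤ.pos-* (i !) _ ⟩
    + (i !) ℤ.* + (i ! * S (suc m) (suc i))
      ≡⟨ cong (+ (i !) ℤ.*_) (diff-pow m i) ⟨
    + (i !) ℤ.* diff i p 0 ∎

  collect : ∀ i → + S k i ℤ.* (sign k ℤ.* sign i ℤ.* + (i !) ℤ.* p i) ≡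
    sign k ℤ.* (sign i ℤ.* + ((i + 1) ^ m * i ! * S k i))
  collect i rewrite ℕ.+-comm i 1 = trans (identity (+ S k i) (sign k) (sign i) (+ (i !)) (p i))
    (cong (λ z → sign k ℤ.* (sign i ℤ.* z))
      (sym (trans (ℤ.pos-* (suc i ^ m * i !) (S k i)) (cong (ℤ._* + S k i) (ℤ.pos-* (suc i ^ m) (i !))))))
    where
    identity : ∀ s a b c d → s ℤ.* (a ℤ.* b ℤ.* c ℤ.* d) ≡ a ℤ.* (b ℤ.* (d ℤ.* c ℤ.* s))
    identity = solve-∀

-- The embedding of the integers into ℚ

fromℚᵘ-homo-+ : ∀ p q → fromℚᵘ (p ℚᵘ.+ q) ≡ fromℚᵘ p ℚ.+ fromℚᵘ q
fromℚᵘ-homo-+ p q = ℚ.toℚᵘ-injective (ℚᵘ.≃-trans (ℚ.toℚᵘ-fromℚᵘ (p ℚᵘ.+ q)) (ℚᵘ.≃-sym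
  (ℚᵘ.≃-trans (ℚ.toℚᵘ-homo-+ (fromℚᵘ p) (fromℚᵘ q)) (ℚᵘ.+-cong (ℚ.toℚᵘ-fromℚᵘ p) (ℚ.toℚᵘ-fromℚᵘ q)))))

fromℚᵘ-homo-* : ∀ p q → fromℚᵘ (p ℚᵘ.* q) ≡ fromℚᵘ p ℚ.* fromℚᵘ q
fromℚᵘ-homo-* p q = ℚ.toℚᵘ-injective (ℚᵘ.≃-trans (ℚ.toℚᵘ-fromℚᵘ (p ℚᵘ.* q)) (ℚᵘ.≃-sym
  (ℚᵘ.≃-trans (ℚ.toℚᵘ-homo-* (fromℚᵘ p) (fromℚᵘ q)) (ℚᵘ.*-cong (ℚ.toℚᵘ-fromℚᵘ p) (ℚ.toℚᵘ-fromℚᵘ q)))))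

ℚfromℤ-+ : ∀ a b → ℚfromℤ (a ℤ.+ b) ≡ ℚfromℤ a ℚ.+ ℚfromℤ b
ℚfromℤ-+ a b = trans (cong ℚfromℤ (cong₂ ℤ._+_ (sym (ℤ.*-identityʳ a)) (sym (ℤ.*-identityʳ b))))
                     (fromℚᵘ-homo-+ (mkℚᵘ a 0) (mkℚᵘ b 0))

ℚfromℤ-* : ∀ a b → ℚfromℤ (a ℤ.* b) ≡ ℚfromℤ a ℚ.* ℚfromℤ b
ℚfromℤ-* a b = fromℚᵘ-homo-* (mkℚᵘ a 0) (mkℚᵘ b 0)

ℚfromℤ-neg : ∀ a → ℚfromℤ (ℤ.- a) ≡ ℚ.- ℚfromℤ a
ℚfromℤ-neg (+ zero)   = refl
ℚfromℤ-neg (+ suc n)  = refl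
ℚfromℤ-neg -[1+ n ]   = sym (solve 1 (λ x → :- (:- x) := x) refl (ℚfromℕ (suc n)))

ℚfromℤ-- : ∀ a b → ℚfromℤ (a ℤ.- b) ≡ ℚfromℤ a ℚ.- ℚfromℤ b
ℚfromℤ-- a b = trans (ℚfromℤ-+ a (ℤ.- b)) (cong (ℚfromℤ a ℚ.+_) (ℚfromℤ-neg b))

ℚfromℕ-* : ∀ a b → ℚfromℕ (a * b) ≡ ℚfromℕ a ℚ.* ℚfromℕ b
ℚfromℕ-* a b = trans (cong ℚfromℤ (ℤ.pos-* a b)) (ℚfromℤ-* (+ a) (+ b))

ℚfromℕ-+ : ∀ a b → ℚfromℕ (a + b) ≡ ℚfromℕ a ℚ.+ ℚfromℕ b
ℚfromℕ-+ a b = trans (cong ℚfromℤ (ℤ.pos-+ a b)) (ℚfromℤ-+ (+ a) (+ b))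

-- Formal power series over ℚ

sumℚ-cong-≤ : ∀ k {f g : ℕ → ℚ} → (∀ i → i ≤ k → f i ≡ g i) → sumℚ k f ≡ sumℚ k g
sumℚ-cong-≤ zero    eq = eq 0 z≤n
sumℚ-cong-≤ (suc k) eq = cong₂ ℚ._+_ (sumℚ-cong-≤ k (λ i i≤k → eq i (ℕ.m≤n⇒m≤1+n i≤k))) (eq (suc k) ℕ.≤-refl)

sumℚ-cong : ∀ k {f g : ℕ → ℚ} → (∀ i → f i ≡ g i) → sumℚ k f ≡ sumℚ k g
sumℚ-cong k eq = sumℚ-cong-≤ k (λ i _ → eq i)

sumℚ-+ : ∀ k (f g : ℕ → ℚ) → sumℚ k (λ i → f i ℚ.+ g i) ≡ sumℚ k f ℚ.+ sumℚ k g
sumℚ-+ zero    f g = refl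
sumℚ-+ (suc k) f g = trans (cong (ℚ._+ (f (suc k) ℚ.+ g (suc k))) (sumℚ-+ k f g))
  (solve 4 (λ a b c d → a :+ b :+ (c :+ d) := a :+ c :+ (b :+ d)) refl
    (sumℚ k f) (sumℚ k g) (f (suc k)) (g (suc k)))

sumℚ-*ˡ : ∀ k c (f : ℕ → ℚ) → sumℚ k (λ i → c ℚ.* f i) ≡ c ℚ.* sumℚ k f
sumℚ-*ˡ zero    c f = refl
sumℚ-*ˡ (suc k) c f = trans (cong (ℚ._+ (c ℚ.* f (suc k))) (sumℚ-*ˡ k c f))
                            (sym (ℚ.*-distribˡ-+ c (sumℚ k f) (f (suc k))))

sumℚ-0 : ∀ k {f : ℕ → ℚ} → (∀ i → i ≤ k → f i ≡ 0ℚ) → sumℚ k f ≡ 0ℚ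
sumℚ-0 zero    eq = eq 0 z≤n
sumℚ-0 (suc k) eq = cong₂ ℚ._+_ (sumℚ-0 k (λ i i≤k → eq i (ℕ.m≤n⇒m≤1+n i≤k))) (eq (suc k) ℕ.≤-refl)

sumℚ-shift : ∀ k (f : ℕ → ℚ) → sumℚ (suc k) f ≡ f 0 ℚ.+ sumℚ k (λ i → f (suc i))
sumℚ-shift zero    f = refl
sumℚ-shift (suc k) f = trans (cong (ℚ._+ f (suc (suc k))) (sumℚ-shift k f))
                             (ℚ.+-assoc (f 0) (sumℚ k (λ i → f (suc i))) (f (suc (suc k))))

ℚfromℤ-sum : ∀ k (f : ℕ → ℤ) → ℚfromℤ (sumℤ k f) ≡ sumℚ k (λ i → ℚfromℤ (f i))
ℚfromℤ-sum zero    f = refl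
ℚfromℤ-sum (suc k) f = trans (ℚfromℤ-+ (sumℤ k f) (f (suc k))) (cong (ℚ._+ ℚfromℤ (f (suc k))) (ℚfromℤ-sum k f))

*ₛ-congˡ : ∀ {f f′ : PS} g → (∀ i → f i ≡ f′ i) → ∀ k → (f *ₛ g) k ≡ (f′ *ₛ g) k
*ₛ-congˡ g eq k = sumℚ-cong k (λ a → cong (ℚ._* g (k ∸ a)) (eq a))

*ₛ-congʳ : ∀ f {g g′ : PS} → (∀ i → g i ≡ g′ i) → ∀ k → (f *ₛ g) k ≡ (f *ₛ g′) k
*ₛ-congʳ f eq k = sumℚ-cong k (λ a → cong (f a ℚ.*_) (eq (k ∸ a)))

*ₛ-linearˡ : ∀ c (f h g : PS) k → ((λ i → c ℚ.* (f i ℚ.- h i)) *ₛ g) k ≡ c ℚ.* ((f *ₛ g) k ℚ.- (h *ₛ g) k)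
*ₛ-linearˡ c f h g k = begin
  sumℚ k (λ a → c ℚ.* (f a ℚ.- h a) ℚ.* g (k ∸ a))
    ≡⟨ sumℚ-cong k (λ a → solve 4 (λ c x y z → c :* (x :- y) :* z := c :* (x :* z) :+ (:- c) :* (y :* z)) refl c (f a) (h a) (g (k ∸ a))) ⟩
  sumℚ k (λ a → c ℚ.* (f a ℚ.* g (k ∸ a)) ℚ.+ ℚ.- c ℚ.* (h a ℚ.* g (k ∸ a)))
    ≡⟨ sumℚ-+ k _ _ ⟩
  sumℚ k (λ a → c ℚ.* (f a ℚ.* g (k ∸ a))) ℚ.+ sumℚ k (λ a → ℚ.- c ℚ.* (h a ℚ.* g (k ∸ a)))
    ≡⟨ cong₂ ℚ._+_ (sumℚ-*ˡ k c _) (sumℚ-*ˡ k (ℚ.- c) _) ⟩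
  c ℚ.* (f *ₛ g) k ℚ.+ ℚ.- c ℚ.* (h *ₛ g) k
    ≡⟨ solve 3 (λ c x y → c :* x :+ (:- c) :* y := c :* (x :- y)) refl c ((f *ₛ g) k) ((h *ₛ g) k) ⟩
  c ℚ.* ((f *ₛ g) k ℚ.- (h *ₛ g) k) ∎

*ₛ-sub : ∀ (f g h : PS) k → (f *ₛ (λ i → g i ℚ.- h i)) k ≡ (f *ₛ g) k ℚ.- (f *ₛ h) k
*ₛ-sub f g h k = begin
  sumℚ k (λ a → f a ℚ.* (g (k ∸ a) ℚ.- h (k ∸ a)))
    ≡⟨ sumℚ-cong k (λ a → solve 3 (λ x y z → x :* (y :- z) := x :* y :+ con (ℚ.- 1ℚ) :* (x :* z)) refl (f a) (g (k ∸ a)) (h (k ∸ a))) ⟩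
  sumℚ k (λ a → f a ℚ.* g (k ∸ a) ℚ.+ ℚ.- 1ℚ ℚ.* (f a ℚ.* h (k ∸ a)))
    ≡⟨ sumℚ-+ k _ _ ⟩
  (f *ₛ g) k ℚ.+ sumℚ k (λ a → ℚ.- 1ℚ ℚ.* (f a ℚ.* h (k ∸ a)))
    ≡⟨ cong ((f *ₛ g) k ℚ.+_) (sumℚ-*ˡ k (ℚ.- 1ℚ) _) ⟩
  (f *ₛ g) k ℚ.+ ℚ.- 1ℚ ℚ.* (f *ₛ h) k
    ≡⟨ solve 2 (λ x y → x :+ con (ℚ.- 1ℚ) :* y := x :- y) refl ((f *ₛ g) k) ((f *ₛ h) k) ⟩
  (f *ₛ g) k ℚ.- (f *ₛ h) k ∎

*ₛ-identityʳ : ∀ f k → (f *ₛ oneₛ) k ≡ f k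
*ₛ-identityʳ f zero    = ℚ.*-identityʳ (f 0)
*ₛ-identityʳ f (suc k) = begin
  sumℚ k (λ a → f a ℚ.* oneₛ (suc k ∸ a)) ℚ.+ f (suc k) ℚ.* oneₛ (k ∸ k)
    ≡⟨ cong₂ ℚ._+_
         (sumℚ-0 k (λ a a≤k → trans (cong (λ d → f a ℚ.* oneₛ d) (ℕ.+-∸-assoc 1 a≤k)) (ℚ.*-zeroʳ (f a))))
         (trans (cong (λ d → f (suc k) ℚ.* oneₛ d) (ℕ.n∸n≡0 k)) (ℚ.*-identityʳ (f (suc k)))) ⟩
  0ℚ ℚ.+ f (suc k)
    ≡⟨ ℚ.+-identityˡ (f (suc k)) ⟩
  f (suc k) ∎

deriv : PS → PS
deriv f k = ℚfromℕ (suc k) ℚ.* f (suc k)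

-- In each summand the factor `suc k` is split as `a` plus `suc k ∸ a`, one part for each
-- derivative. The first family vanishes at `a = 0` and the second at `a = suc k`, so both ranges
-- shrink to those of products in degree `k`.
deriv-*ₛ : ∀ f g k → deriv (f *ₛ g) k ≡ (deriv f *ₛ g) k ℚ.+ (f *ₛ deriv g) k
deriv-*ₛ f g k = begin
  K ℚ.* sumℚ (suc k) (λ a → f a ℚ.* g (suc k ∸ a))
    ≡⟨ sumℚ-*ˡ (suc k) K _ ⟨
  sumℚ (suc k) (λ a → K ℚ.* (f a ℚ.* g (suc k ∸ a)))
    ≡⟨ trans (sumℚ-cong-≤ (suc k) split) (sumℚ-+ (suc k) F G) ⟩
  sumℚ (suc k) F ℚ.+ sumℚ (suc k) G
    ≡⟨ cong₂ ℚ._+_ left right ⟩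
  (deriv f *ₛ g) k ℚ.+ (f *ₛ deriv g) k ∎
  where
  K : ℚ
  K = ℚfromℕ (suc k)
  F G : ℕ → ℚ
  F a = ℚfromℕ a ℚ.* f a ℚ.* g (suc k ∸ a)
  G a = f a ℚ.* (ℚfromℕ (suc k ∸ a) ℚ.* g (suc k ∸ a))

  split : ∀ a → a ≤ suc k → K ℚ.* (f a ℚ.* g (suc k ∸ a)) ≡ F a ℚ.+ G a
  split a a≤ = trans
    (cong (ℚ._* (f a ℚ.* g (suc k ∸ a))) (trans (cong ℚfromℕ (sym (ℕ.m+[n∸m]≡n a≤))) (ℚfromℕ-+ a (suc k ∸ a))))
    (solve 4 (λ p q x y → (p :+ q) :* (x :* y) := p :* x :* y :+ x :* (q :* y)) refl
      (ℚfromℕ a) (ℚfromℕ (suc k ∸ a)) (f a) (g (suc k ∸ a)))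

  left : sumℚ (suc k) F ≡ (deriv f *ₛ g) k
  left = trans (sumℚ-shift k F)
    (solve 3 (λ x y s → con 0ℚ :* x :* y :+ s := s) refl (f 0) (g (suc k)) ((deriv f *ₛ g) k))

  right : sumℚ (suc k) G ≡ (f *ₛ deriv g) k
  right = trans
    (cong₂ ℚ._+_
      (sumℚ-cong-≤ k (λ a a≤k → cong (λ d → f a ℚ.* (ℚfromℕ d ℚ.* g d)) (ℕ.+-∸-assoc 1 a≤k)))
      (cong (λ d → f (suc k) ℚ.* (ℚfromℕ d ℚ.* g d)) (ℕ.n∸n≡0 k)))
    (solve 3 (λ x y s → s :+ x :* (con 0ℚ :* y) := s) refl (f (suc k)) (g 0) ((f *ₛ deriv g) k))

-- The powers of z = 1 - exp (-x)

suc-*-/ : ∀ s m d .{{_ : NonZero d}} .{{_ : NonZero (suc m * d)}} → ℚfromℕ (suc m) ℚ.* (s ℚ./ (suc m * d)) ≡ s ℚ./ d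
suc-*-/ s m (suc d) = trans
  (sym (fromℚᵘ-homo-* (mkℚᵘ (+ suc m) 0) (mkℚᵘ s (d + m * suc d))))
  (ℚ.fromℚᵘ-cong {mkℚᵘ (+ suc m) 0 ℚᵘ.* mkℚᵘ s (d + m * suc d)} {mkℚᵘ s d} (*≡* eq))
  where
  swap : ∀ a s d → a ℤ.* s ℤ.* d ≡ s ℤ.* (a ℤ.* d)
  swap = solve-∀
  eq : + suc m ℤ.* s ℤ.* + suc d ≡ s ℤ.* + suc (d + m * suc d + 0)
  eq = trans (swap (+ suc m) s (+ suc d))
    (cong (s ℤ.*_) (trans (sym (ℤ.pos-* (suc m) (suc d))) (cong (λ x → + suc x) (sym (ℕ.+-identityʳ (d + m * suc d))))))

/-neg : ∀ s d .{{_ : NonZero d}} → (ℤ.- s) ℚ./ d ≡ ℚ.- (s ℚ./ d)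
/-neg (+ zero)  d = trans (ℚ.0/n≡0 d) (sym (cong ℚ.-_ (ℚ.0/n≡0 d)))
/-neg (+ suc n) d = refl
/-neg -[1+ n ]  d = sym (solve 1 (λ x → :- (:- x) := x) refl (+ suc n ℚ./ d))

deriv-expNeg : ∀ k → deriv expNeg k ≡ ℚ.- expNeg k
deriv-expNeg k = trans (suc-*-/ (sign (suc k)) k (k !)) (/-neg (sign k) (k !))
  where instance _ = k ℕ.!≢0
                 _ = suc k ℕ.!≢0

deriv-zₛ : ∀ k → deriv zₛ k ≡ oneₛ k ℚ.- zₛ k
deriv-zₛ k = begin
  K ℚ.* (0ℚ ℚ.- expNeg (suc k))
    ≡⟨ solve 2 (λ c e → c :* (con 0ℚ :- e) := :- (c :* e)) refl K (expNeg (suc k)) ⟩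
  ℚ.- (K ℚ.* expNeg (suc k))
    ≡⟨ cong ℚ.-_ (deriv-expNeg k) ⟩
  ℚ.- (ℚ.- expNeg k)
    ≡⟨ solve 2 (λ o e → :- (:- e) := o :- (o :- e)) refl (oneₛ k) (expNeg k) ⟩
  oneₛ k ℚ.- (oneₛ k ℚ.- expNeg k) ∎
  where
  K : ℚ
  K = ℚfromℕ (suc k)

-- Product rule for z^q times z, by induction on `q`. As z′ = 1 - z, the factor z contributes z^q -
-- z^(q+1) once, and by induction the factor z^q contributes the same difference `q` times.
deriv-zₛ^ : ∀ q k → deriv (zₛ ^ₛ suc q) k ≡ ℚfromℕ (suc q) ℚ.* ((zₛ ^ₛ q) k ℚ.- (zₛ ^ₛ suc q) k)
deriv-zₛ^ q k = begin
  deriv (zₛ ^ₛ suc q) k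
    ≡⟨ deriv-*ₛ (zₛ ^ₛ q) zₛ k ⟩
  (deriv (zₛ ^ₛ q) *ₛ zₛ) k ℚ.+ ((zₛ ^ₛ q) *ₛ deriv zₛ) k
    ≡⟨ cong₂ ℚ._+_ (inner q) outer ⟩
  ℚfromℕ q ℚ.* (x ℚ.- y) ℚ.+ (x ℚ.- y)
    ≡⟨ solve 2 (λ c d → c :* d :+ d := (con 1ℚ :+ c) :* d) refl (ℚfromℕ q) (x ℚ.- y) ⟩
  (1ℚ ℚ.+ ℚfromℕ q) ℚ.* (x ℚ.- y)
    ≡⟨ cong (ℚ._* (x ℚ.- y)) (ℚfromℕ-+ 1 q) ⟨
  ℚfromℕ (suc q) ℚ.* (x ℚ.- y) ∎
  where
  x y : ℚ
  x = (zₛ ^ₛ q) k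
  y = (zₛ ^ₛ suc q) k

  outer : ((zₛ ^ₛ q) *ₛ deriv zₛ) k ≡ x ℚ.- y
  outer = trans (*ₛ-congʳ (zₛ ^ₛ q) deriv-zₛ k)
    (trans (*ₛ-sub (zₛ ^ₛ q) oneₛ zₛ k) (cong (ℚ._- y) (*ₛ-identityʳ (zₛ ^ₛ q) k)))

  inner : ∀ q → (deriv (zₛ ^ₛ q) *ₛ zₛ) k ≡ ℚfromℕ q ℚ.* ((zₛ ^ₛ q) k ℚ.- (zₛ ^ₛ suc q) k)
  -- The induction hypothesis speaks of positive exponents only; here the differentiated power is
  -- the constant series 1.
  inner zero    = trans
    (sumℚ-0 k (λ a _ → trans (cong (ℚ._* zₛ (k ∸ a)) (ℚ.*-zeroʳ (ℚfromℕ (suc a)))) (ℚ.*-zeroˡ (zₛ (k ∸ a)))))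
    (sym (ℚ.*-zeroˡ ((zₛ ^ₛ 0) k ℚ.- (zₛ ^ₛ 1) k)))
  inner (suc q) = trans (*ₛ-congˡ zₛ (deriv-zₛ^ q) k)
    (*ₛ-linearˡ (ℚfromℕ (suc q)) (zₛ ^ₛ q) (zₛ ^ₛ suc q) zₛ k)

-- The classical generating function (e^x - 1)^q = q! Σ S(k,q) x^k / k!, taken at -x and multiplied
-- by (-1)^q. Comparing coefficients in `deriv-zₛ^` gives the Stirling recurrence, with the signs
-- absorbing the minus.
coeff-zₛ^ : ∀ k q → ℚfromℕ (k !) ℚ.* (zₛ ^ₛ q) k ≡ ℚfromℤ (sign k ℤ.* sign q ℤ.* + (q ! * S k q))
coeff-zₛ^ zero zero    = refl
coeff-zₛ^ zero (suc q) = trans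
  (solve 1 (λ x → con 1ℚ :* (x :* con 0ℚ) := con 0ℚ) refl ((zₛ ^ₛ q) 0))
  (sym (cong ℚfromℤ (trans (cong (λ z → + 1 ℤ.* sign (suc q) ℤ.* + z) (ℕ.*-zeroʳ (suc q !))) (ℤ.*-zeroʳ (+ 1 ℤ.* sign (suc q))))))
coeff-zₛ^ (suc k) zero = trans (ℚ.*-zeroʳ (ℚfromℕ (suc k !))) (sym (cong ℚfromℤ (ℤ.*-zeroʳ (sign (suc k) ℤ.* + 1))))
coeff-zₛ^ (suc k) (suc q) = begin
  ℚfromℕ (suc k * k !) ℚ.* (zₛ ^ₛ suc q) (suc k)
    ≡⟨ cong (ℚ._* (zₛ ^ₛ suc q) (suc k)) (ℚfromℕ-* (suc k) (k !)) ⟩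
  ℚfromℕ (suc k) ℚ.* ℚfromℕ (k !) ℚ.* (zₛ ^ₛ suc q) (suc k)
    ≡⟨ solve 3 (λ a b c → a :* b :* c := b :* (a :* c)) refl (ℚfromℕ (suc k)) (ℚfromℕ (k !)) ((zₛ ^ₛ suc q) (suc k)) ⟩
  ℚfromℕ (k !) ℚ.* deriv (zₛ ^ₛ suc q) k
    ≡⟨ cong (ℚfromℕ (k !) ℚ.*_) (deriv-zₛ^ q k) ⟩
  ℚfromℕ (k !) ℚ.* (ℚfromℕ (suc q) ℚ.* ((zₛ ^ₛ q) k ℚ.- (zₛ ^ₛ suc q) k))
    ≡⟨ solve 4 (λ a b x y → a :* (b :* (x :- y)) := b :* (a :* x :- a :* y)) refl (ℚfromℕ (k !)) (ℚfromℕ (suc q)) ((zₛ ^ₛ q) k) ((zₛ ^ₛ suc q) k) ⟩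
  ℚfromℕ (suc q) ℚ.* (ℚfromℕ (k !) ℚ.* (zₛ ^ₛ q) k ℚ.- ℚfromℕ (k !) ℚ.* (zₛ ^ₛ suc q) k)
    ≡⟨ cong₂ (λ x y → ℚfromℕ (suc q) ℚ.* (x ℚ.- y)) (coeff-zₛ^ k q) (coeff-zₛ^ k (suc q)) ⟩
  ℚfromℕ (suc q) ℚ.* (ℚfromℤ a ℚ.- ℚfromℤ b)
    ≡⟨ trans (ℚfromℤ-* (+ suc q) (a ℤ.- b)) (cong (ℚfromℕ (suc q) ℚ.*_) (ℚfromℤ-- a b)) ⟨
  ℚfromℤ (+ suc q ℤ.* (a ℤ.- b))
    ≡⟨ cong ℚfromℤ recurrence ⟩
  ℚfromℤ (sign (suc k) ℤ.* sign (suc q) ℤ.* + (suc q ! * S (suc k) (suc q))) ∎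
  where
  a b : ℤ
  a = sign k ℤ.* sign q ℤ.* + (q ! * S k q)
  b = sign k ℤ.* sign (suc q) ℤ.* + (suc q ! * S k (suc q))

  pos : ∀ t → + (suc q ! * t) ≡ + suc q ℤ.* + (q !) ℤ.* + t
  pos t = trans (ℤ.pos-* (suc q !) t) (cong (ℤ._* + t) (pos-! q))

  identity : ∀ s t j p x y → j ℤ.* (s ℤ.* t ℤ.* (p ℤ.* x) ℤ.- s ℤ.* (ℤ.- t) ℤ.* (j ℤ.* p ℤ.* y)) ≡
    (ℤ.- s) ℤ.* (ℤ.- t) ℤ.* (j ℤ.* p ℤ.* (j ℤ.* y ℤ.+ x))
  identity = solve-∀

  recurrence : + suc q ℤ.* (a ℤ.- b) ≡ sign (suc k) ℤ.* sign (suc q) ℤ.* + (suc q ! * S (suc k) (suc q))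
  recurrence = begin
    + suc q ℤ.* (a ℤ.- b)
      ≡⟨ cong₂ (λ x y → + suc q ℤ.* (sign k ℤ.* sign q ℤ.* x ℤ.- sign k ℤ.* sign (suc q) ℤ.* y))
           (ℤ.pos-* (q !) (S k q)) (pos (S k (suc q))) ⟩
    + suc q ℤ.* (sign k ℤ.* sign q ℤ.* (+ (q !) ℤ.* + S k q) ℤ.- sign k ℤ.* (ℤ.- sign q) ℤ.* (+ suc q ℤ.* + (q !) ℤ.* + S k (suc q)))
      ≡⟨ identity (sign k) (sign q) (+ suc q) (+ (q !)) (+ S k q) (+ S k (suc q)) ⟩
    (ℤ.- sign k) ℤ.* (ℤ.- sign q) ℤ.* (+ suc q ℤ.* + (q !) ℤ.* (+ suc q ℤ.* + S k (suc q) ℤ.+ + S k q))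
      ≡⟨ cong (λ z → sign (suc k) ℤ.* sign (suc q) ℤ.* z) (trans (pos (S (suc k) (suc q))) (cong (+ suc q ℤ.* + (q !) ℤ.*_) (S-suc k q))) ⟨
    sign (suc k) ℤ.* sign (suc q) ℤ.* + (suc q ! * S (suc k) (suc q)) ∎

-- At a negative index the coefficients of the polylogarithm are the integers r^(m+1), so after
-- multiplication by k! every summand is an integer given by `coeff-zₛ^`.
polyBernoulli-alternating : ∀ k m → polyBernoulli k -[1+ m ] ≡
  ℚfromℤ (sign k ℤ.* sumℤ k (λ i → sign i ℤ.* + ((i + 1) ^ suc m * i ! * S k i)))
polyBernoulli-alternating k m = begin
  ℚfromℕ (k !) ℚ.* sumℚ k (λ q → ℚfromℕ (suc q ^ suc m) ℚ.* (zₛ ^ₛ q) k)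
    ≡⟨ sumℚ-*ˡ k (ℚfromℕ (k !)) _ ⟨
  sumℚ k (λ q → ℚfromℕ (k !) ℚ.* (ℚfromℕ (suc q ^ suc m) ℚ.* (zₛ ^ₛ q) k))
    ≡⟨ sumℚ-cong k term ⟩
  sumℚ k (λ q → ℚfromℤ (sign k ℤ.* (sign q ℤ.* + ((q + 1) ^ suc m * q ! * S k q))))
    ≡⟨ ℚfromℤ-sum k _ ⟨
  ℚfromℤ (sumℤ k (λ q → sign k ℤ.* (sign q ℤ.* + ((q + 1) ^ suc m * q ! * S k q))))
    ≡⟨ cong ℚfromℤ (sumℤ-*ˡ k (sign k) _) ⟩
  ℚfromℤ (sign k ℤ.* sumℤ k (λ q → sign q ℤ.* + ((q + 1) ^ suc m * q ! * S k q))) ∎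
  where
  identity : ∀ P s t x → P ℤ.* (s ℤ.* t ℤ.* x) ≡ s ℤ.* (t ℤ.* (P ℤ.* x))
  identity = solve-∀

  term : ∀ q → ℚfromℕ (k !) ℚ.* (ℚfromℕ (suc q ^ suc m) ℚ.* (zₛ ^ₛ q) k) ≡
    ℚfromℤ (sign k ℤ.* (sign q ℤ.* + ((q + 1) ^ suc m * q ! * S k q)))
  term q rewrite ℕ.+-comm q 1 = begin
    ℚfromℕ (k !) ℚ.* (ℚfromℕ P ℚ.* (zₛ ^ₛ q) k)
      ≡⟨ solve 3 (λ a b c → a :* (b :* c) := b :* (a :* c)) refl (ℚfromℕ (k !)) (ℚfromℕ P) ((zₛ ^ₛ q) k) ⟩
    ℚfromℕ P ℚ.* (ℚfromℕ (k !) ℚ.* (zₛ ^ₛ q) k)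
      ≡⟨ cong (ℚfromℕ P ℚ.*_) (coeff-zₛ^ k q) ⟩
    ℚfromℕ P ℚ.* ℚfromℤ (sign k ℤ.* sign q ℤ.* + (q ! * S k q))
      ≡⟨ ℚfromℤ-* (+ P) _ ⟨
    ℚfromℤ (+ P ℤ.* (sign k ℤ.* sign q ℤ.* + (q ! * S k q)))
      ≡⟨ cong ℚfromℤ (trans (identity (+ P) (sign k) (sign q) (+ (q ! * S k q)))
           (cong (λ z → sign k ℤ.* (sign q ℤ.* z)) (trans (sym (ℤ.pos-* P (q ! * S k q))) (cong +_ (sym (ℕ.*-assoc P (q !) (S k q))))))) ⟩
    ℚfromℤ (sign k ℤ.* (sign q ℤ.* + (P * q ! * S k q))) ∎
    where
    P = suc q ^ suc m

polyBernoulli-stirlingSum : ∀ k m → ℚfromℕ (stirlingSum k (suc m)) ≡ polyBernoulli k -[1+ m ]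
polyBernoulli-stirlingSum k m = trans (cong ℚfromℤ (stirlingSum-alternating k (suc m))) (sym (polyBernoulli-alternating k m))

-- Permanents of matrices indexed by lists

-- The sum runs over positions, not values: `F` receives an entry together with the list from which
-- this one occurrence is removed. Repeated labels therefore count with multiplicity.
pickSum : {A : Set} → (A → List A → ℕ) → List A → ℕ
pickSum F []       = 0
pickSum F (x ∷ xs) = F x xs + pickSum (λ y ys → F y (x ∷ ys)) xs

module _ {A : Set} where

  pickSum-cong : {F G : A → List A → ℕ} → (∀ x xs → F x xs ≡ G x xs) → ∀ xs → pickSum F xs ≡ pickSum G xs
  pickSum-cong eq []       = refl
  pickSum-cong eq (x ∷ xs) = cong₂ _+_ (eq x xs) (pickSum-cong (λ y ys → eq y (x ∷ ys)) xs)

  pickSum-+ : ∀ (F G : A → List A → ℕ) xs →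
    pickSum (λ x ys → F x ys + G x ys) xs ≡ pickSum F xs + pickSum G xs
  pickSum-+ F G []       = refl
  pickSum-+ F G (x ∷ xs) = trans
    (cong ((F x xs + G x xs) ℕ.+_) (pickSum-+ (λ y ys → F y (x ∷ ys)) (λ y ys → G y (x ∷ ys)) xs))
    (exchange (F x xs) (G x xs) _ _)
    where
    exchange : ∀ a b c d → a + b + (c + d) ≡ a + c + (b + d)
    exchange = ℕSolver.solve-∀

  pickSum-*ˡ : ∀ c (F : A → List A → ℕ) xs → pickSum (λ x ys → c * F x ys) xs ≡ c * pickSum F xs
  pickSum-*ˡ c F []       = sym (ℕ.*-zeroʳ c)
  pickSum-*ˡ c F (x ∷ xs) = trans
    (cong (c * F x xs ℕ.+_) (pickSum-*ˡ c (λ y ys → F y (x ∷ ys)) xs))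
    (sym (ℕ.*-distribˡ-+ c (F x xs) _))

  pickSum-weight-0 : (w : A → ℕ) (P : List A → ℕ) {xs : List A} → All (λ x → w x ≡ 0) xs →
    pickSum (λ x ys → w x * P ys) xs ≡ 0
  pickSum-weight-0 w P []                          = refl
  pickSum-weight-0 w P {x ∷ xs} (wx≡0 ∷ rest) =
    cong₂ _+_ (cong (_* P xs) wx≡0) (pickSum-weight-0 w (P ∘ (x ∷_)) rest)

  pickSum-replicate : (w : A → ℕ) {x : A} → w x ≡ 1 → ∀ c (P : List A → ℕ) {xs : List A} → All (λ y → w y ≡ 0) xs →
    pickSum (λ y ys → w y * P ys) (replicate (suc c) x ++ xs) ≡ suc c * P (replicate c x ++ xs)
  pickSum-replicate w {x = x} wx≡1 zero P {xs} zeros = cong₂ _+_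
    (trans (cong (_* P xs) wx≡1) (ℕ.*-identityˡ (P xs)))
    (pickSum-weight-0 w (P ∘ (x ∷_)) zeros)
  pickSum-replicate w {x = x} wx≡1 (suc c) P {xs} zeros = cong₂ _+_
    (trans (cong (_* P (replicate (suc c) x ++ xs)) wx≡1) (ℕ.*-identityˡ _))
    (pickSum-replicate w wx≡1 c (P ∘ (x ∷_)) zeros)

  pickSum-↭ : {F : A → List A → ℕ} → (∀ x {xs ys} → xs ↭ ys → F x xs ≡ F x ys) →
    ∀ {xs ys} → xs ↭ ys → pickSum F xs ≡ pickSum F ys
  pickSum-↭ resp Perm.refl         = refl
  pickSum-↭ resp (Perm.prep x p)   = cong₂ _+_ (resp x p) (pickSum-↭ (λ y q → resp y (Perm.prep x q)) p)
  pickSum-↭ {F} resp (Perm.swap {xs} {ys} x y p) = begin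
    F x (y ∷ xs) + (F y (x ∷ xs) + pickSum (λ z zs → F z (x ∷ y ∷ zs)) xs)
      ≡⟨ cong₂ _+_ (resp x (Perm.prep y p)) (cong₂ _+_ (resp y (Perm.prep x p)) tails) ⟩
    F x (y ∷ ys) + (F y (x ∷ ys) + pickSum (λ z zs → F z (y ∷ x ∷ zs)) ys)
      ≡⟨ exchange (F x (y ∷ ys)) (F y (x ∷ ys)) _ ⟩
    F y (x ∷ ys) + (F x (y ∷ ys) + pickSum (λ z zs → F z (y ∷ x ∷ zs)) ys) ∎
    where
    exchange : ∀ a b c → a + (b + c) ≡ b + (a + c)
    exchange = ℕSolver.solve-∀
    tails = trans (pickSum-↭ (λ z q → resp z (Perm.prep x (Perm.prep y q))) p)
                    (pickSum-cong (λ z zs → resp z (Perm.swap x y Perm.refl)) ys)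
  pickSum-↭ resp (Perm.trans p q) = trans (pickSum-↭ resp p) (pickSum-↭ resp q)

pickSum-comm : ∀ {A B : Set} (F : A → List A → B → List B → ℕ) xs ys →
  pickSum (λ x xs′ → pickSum (F x xs′) ys) xs ≡ pickSum (λ y ys′ → pickSum (λ x xs′ → F x xs′ y ys′) xs) ys
pickSum-comm F [] ys = zeros ys
  where
  zeros : ∀ {B : Set} (ys : List B) → 0 ≡ pickSum (λ _ _ → 0) ys
  zeros []       = refl
  zeros (_ ∷ ys) = zeros ys
pickSum-comm F (x ∷ xs) ys = trans
  (cong (pickSum (F x xs) ys ℕ.+_) (pickSum-comm (λ y ys′ → F y (x ∷ ys′)) xs ys))
  (sym (pickSum-+ (F x xs) (λ y ys′ → pickSum (λ z zs → F z (x ∷ zs) y ys′) xs) ys))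

pickSum-Pointwise : ∀ {A B : Set} {_∼_ : A → B → Set} {F : A → List A → ℕ} {G : B → List B → ℕ} →
  (∀ {x y xs ys} → x ∼ y → Pointwise _∼_ xs ys → F x xs ≡ G y ys) →
  ∀ {xs ys} → Pointwise _∼_ xs ys → pickSum F xs ≡ pickSum G ys
pickSum-Pointwise eq []            = refl
pickSum-Pointwise eq (x∼y ∷ xs∼ys) =
  cong₂ _+_ (eq x∼y xs∼ys) (pickSum-Pointwise (λ p ps → eq p (x∼y ∷ ps)) xs∼ys)

-- The permanent is 0 if the matrix is not square.
module _ {R C : Set} (w : R → C → ℕ) where

  per : List R → List C → ℕ
  per []       []      = 1
  per []       (_ ∷ _) = 0
  per (r ∷ rs) cs      = pickSum (λ c cs′ → w r c * per rs cs′) cs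

module _ {R C : Set} (w : R → C → ℕ) where

  -- The definition of `per` expands along rows; this restores the symmetry between rows and
  -- columns. Any row but the first is reached by expanding along the first row, applying induction,
  -- and interchanging the two choices. Invariance under row permutations and linearity in a column
  -- follow from it.
  per-expand-column : ∀ rs c cs → per w rs (c ∷ cs) ≡ pickSum (λ r rs′ → w r c * per w rs′ cs) rs
  per-expand-column []       c cs = refl
  per-expand-column (r ∷ rs) c cs = cong (w r c * per w rs cs ℕ.+_) (begin
    pickSum (λ c′ cs′ → w r c′ * per w rs (c ∷ cs′)) cs
      ≡⟨ pickSum-cong (λ c′ cs′ → trans (cong (w r c′ *_) (per-expand-column rs c cs′)) (sym (pickSum-*ˡ (w r c′) _ rs))) cs ⟩
    pickSum (λ c′ cs′ → pickSum (λ r′ rs′ → w r c′ * (w r′ c * per w rs′ cs′)) rs) cs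
      ≡⟨ pickSum-comm _ cs rs ⟩
    pickSum (λ r′ rs′ → pickSum (λ c′ cs′ → w r c′ * (w r′ c * per w rs′ cs′)) cs) rs
      ≡⟨ pickSum-cong (λ r′ rs′ → trans
           (pickSum-cong (λ c′ cs′ → exchange (w r c′) (w r′ c) (per w rs′ cs′)) cs)
           (pickSum-*ˡ (w r′ c) _ cs)) rs ⟩
    pickSum (λ r′ rs′ → w r′ c * per w (r ∷ rs′) cs) rs ∎)
    where
    exchange : ∀ a b c → a * (b * c) ≡ b * (a * c)
    exchange = ℕSolver.solve-∀

  per-↭-columns : ∀ rs {cs cs′} → cs ↭ cs′ → per w rs cs ≡ per w rs cs′
  per-↭-columns [] {[]}    {[]}    p = refl
  per-↭-columns [] {[]}    {_ ∷ _} p = contradiction (↭-sym p) ↭.¬x∷xs↭[]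
  per-↭-columns [] {_ ∷ _} {[]}    p = contradiction p ↭.¬x∷xs↭[]
  per-↭-columns [] {_ ∷ _} {_ ∷ _} p = refl
  per-↭-columns (r ∷ rs) p = pickSum-↭ (λ c q → cong (w r c *_) (per-↭-columns rs q)) p

  per-↭-rows : ∀ {rs rs′} cs → rs ↭ rs′ → per w rs cs ≡ per w rs′ cs
  per-↭-rows {[]}    {[]}    [] p = refl
  per-↭-rows {[]}    {_ ∷ _} [] p = contradiction (↭-sym p) ↭.¬x∷xs↭[]
  per-↭-rows {_ ∷ _} {[]}    [] p = contradiction p ↭.¬x∷xs↭[]
  per-↭-rows {_ ∷ _} {_ ∷ _} [] p = refl
  per-↭-rows {rs} {rs′} (c ∷ cs) p = begin
    per w rs (c ∷ cs)                              ≡⟨ per-expand-column rs c cs ⟩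
    pickSum (λ r rs″ → w r c * per w rs″ cs) rs  ≡⟨ pickSum-↭ (λ r q → cong (w r c *_) (per-↭-rows cs q)) p ⟩
    pickSum (λ r rs″ → w r c * per w rs″ cs) rs′ ≡⟨ per-expand-column rs′ c cs ⟨
    per w rs′ (c ∷ cs) ∎

  per-↭ : ∀ {rs rs′ cs cs′} → rs ↭ rs′ → cs ↭ cs′ → per w rs cs ≡ per w rs′ cs′
  per-↭ {rs′ = rs′} {cs} p q = trans (per-↭-rows cs p) (per-↭-columns rs′ q)

  per-split-row : ∀ {x y z} → (∀ c → w x c ≡ w y c + w z c) →
    ∀ rs cs → per w (x ∷ rs) cs ≡ per w (y ∷ rs) cs + per w (z ∷ rs) cs
  per-split-row {x} {y} {z} eq rs cs = trans
    (pickSum-cong (λ c cs′ → trans (cong (_* per w rs cs′) (eq c)) (ℕ.*-distribʳ-+ (per w rs cs′) (w y c) (w z c))) cs)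
    (pickSum-+ _ _ cs)

  per-split-column : ∀ {x y z} → (∀ r → w r x ≡ w r y + w r z) →
    ∀ rs cs → per w rs (x ∷ cs) ≡ per w rs (y ∷ cs) + per w rs (z ∷ cs)
  per-split-column {x} {y} {z} eq rs cs = begin
    per w rs (x ∷ cs)
      ≡⟨ per-expand-column rs x cs ⟩
    pickSum (λ r rs′ → w r x * per w rs′ cs) rs
      ≡⟨ pickSum-cong (λ r rs′ → trans (cong (_* per w rs′ cs) (eq r)) (ℕ.*-distribʳ-+ (per w rs′ cs) (w r y) (w r z))) rs ⟩
    pickSum (λ r rs′ → w r y * per w rs′ cs + w r z * per w rs′ cs) rs
      ≡⟨ pickSum-+ _ _ rs ⟩
    pickSum (λ r rs′ → w r y * per w rs′ cs) rs + pickSum (λ r rs′ → w r z * per w rs′ cs) rs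
      ≡⟨ cong₂ _+_ (per-expand-column rs y cs) (per-expand-column rs z cs) ⟨
    per w rs (y ∷ cs) + per w rs (z ∷ cs) ∎

-- Matching lines by relations rather than by functions lets a relabelling depend on the place in
-- the list. This serves both to shift a staircase and to pass from indices in `Fin n` to labels.
per-Pointwise : ∀ {R R′ C C′ : Set} {w : R → C → ℕ} {w′ : R′ → C′ → ℕ} {_∼_ : R → R′ → Set} {_≈_ : C → C′ → Set} →
  (∀ {r r′ c c′} → r ∼ r′ → c ≈ c′ → w r c ≡ w′ r′ c′) →
  ∀ {rs rs′ cs cs′} → Pointwise _∼_ rs rs′ → Pointwise _≈_ cs cs′ → per w rs cs ≡ per w′ rs′ cs′
per-Pointwise eq []       []      = refl
per-Pointwise eq []       (_ ∷ _) = refl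
per-Pointwise eq (p ∷ ps) qs      = pickSum-Pointwise (λ q qs′ → cong₂ _*_ (eq p q) (per-Pointwise eq ps qs′)) qs

applyUpTo-Pointwise : ∀ {A B : Set} {_∼_ : A → B → Set} {f : ℕ → A} {g : ℕ → B} →
  (∀ i → f i ∼ g i) → ∀ n → Pointwise _∼_ (applyUpTo f n) (applyUpTo g n)
applyUpTo-Pointwise eq zero    = []
applyUpTo-Pointwise eq (suc n) = eq 0 ∷ applyUpTo-Pointwise (eq ∘ suc) n

-- The block matrix of the band

-- Defined by recursion on both arguments so that shifting a staircase by one row and one column
-- preserves its entries definitionally.
leq : ℕ → ℕ → ℕ
leq zero    _       = 1
leq (suc a) zero    = 0
leq (suc a) (suc b) = leq a b

-- A deferred row is a top row that has to use a small column, and a free column is a large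
-- column open to all remaining top rows.  Dually, a reserved column is a small column kept for
-- deferred rows.  The remaining constructors express mixed = deferred + pooled (rows) and
-- either = free + reserved (columns).
data Row : Set where
  top bot               : ℕ → Row
  deferred pooled mixed : Row

data Col : Set where
  large small          : ℕ → Col
  free reserved either : Col

weight : Row → Col → ℕ
weight (top p)  (large s) = leq s p
weight (top p)  (small y) = 1
weight (top p)  free      = 1
weight (top p)  reserved  = 0
weight (top p)  either    = 1
weight (bot r)  (large s) = 1
weight (bot r)  (small y) = leq y r
weight (bot r)  free      = 1
weight (bot r)  reserved  = 0
weight (bot r)  either    = 1
weight deferred (large s) = 0
weight deferred (small y) = 1
weight deferred free      = 0
weight deferred reserved  = 1
weight deferred either    = 1
weight pooled   (large s) = 0
weight pooled   (small y) = 0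
weight pooled   free      = 1
weight pooled   reserved  = 0
weight pooled   either    = 1
weight mixed    (large s) = 0
weight mixed    (small y) = 1
weight mixed    free      = 1
weight mixed    reserved  = 1
weight mixed    either    = 2

weight-mixed : ∀ c → weight mixed c ≡ weight deferred c + weight pooled c
weight-mixed (large s) = refl
weight-mixed (small y) = refl
weight-mixed free      = refl
weight-mixed reserved  = refl
weight-mixed either    = refl

weight-either : ∀ r → weight r either ≡ weight r free + weight r reserved
weight-either (top p)  = refl
weight-either (bot r)  = refl
weight-either deferred = refl
weight-either pooled   = refl
weight-either mixed    = refl

tops bots : ℕ → List Row
tops = applyUpTo top
bots = applyUpTo bot

larges smalls : ℕ → List Col
larges = applyUpTo large
smalls = applyUpTo small

per-pooled : ∀ rs c {cs} → All (λ x → weight pooled x ≡ 0) cs →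
  per weight (pooled ∷ rs) (replicate (suc c) free ++ cs) ≡ suc c * per weight rs (replicate c free ++ cs)
per-pooled rs c = pickSum-replicate (weight pooled) refl c (per weight rs)

-- The state of the elimination of the upper staircase: `a` rows have been deferred, and each has
-- left behind one free column, which keeps the matrix square.
bandPer : ℕ → ℕ → ℕ → ℕ
bandPer k m a = per weight (replicate a deferred ++ tops k ++ bots m) (replicate a free ++ larges k ++ smalls m)

-- In the staircase, `top 0` meets only `large 0`, and `large 0` meets every top row. Hence
-- `large 0` behaves as a free column, and `top 0` as a row confined to free and small columns; the
-- other staircase labels drop by one.
data _∼₁_ : Row → Row → Set where
  deferred : deferred ∼₁ deferred
  top-zero : top 0 ∼₁ mixed
  top-suc  : ∀ p → top (suc p) ∼₁ top p
  bot      : ∀ r → bot r ∼₁ bot r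

data _≈₁_ : Col → Col → Set where
  free       : free ≈₁ free
  large-zero : large 0 ≈₁ free
  large-suc  : ∀ s → large (suc s) ≈₁ large s
  small      : ∀ y → small y ≈₁ small y

weight-shift₁ : ∀ {r r′ c c′} → r ∼₁ r′ → c ≈₁ c′ → weight r c ≡ weight r′ c′
weight-shift₁ deferred    free          = refl
weight-shift₁ deferred    large-zero    = refl
weight-shift₁ deferred    (large-suc s) = refl
weight-shift₁ deferred    (small y)     = refl
weight-shift₁ top-zero    free          = refl
weight-shift₁ top-zero    large-zero    = refl
weight-shift₁ top-zero    (large-suc s) = refl
weight-shift₁ top-zero    (small y)     = refl
weight-shift₁ (top-suc p) free          = refl
weight-shift₁ (top-suc p) large-zero    = refl
weight-shift₁ (top-suc p) (large-suc s) = refl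
weight-shift₁ (top-suc p) (small y)     = refl
weight-shift₁ (bot r)     free          = refl
weight-shift₁ (bot r)     large-zero    = refl
weight-shift₁ (bot r)     (large-suc s) = refl
weight-shift₁ (bot r)     (small y)     = refl

-- The corner row either takes one of the `suc a` free columns, the new one included, or it is
-- deferred to a small column. Splitting `mixed` separates the two cases.
bandPer-suc : ∀ k m a → bandPer (suc k) m a ≡ suc a * bandPer k m a + bandPer k m (suc a)
bandPer-suc k m a = begin
  bandPer (suc k) m a
    ≡⟨ per-Pointwise {_∼_ = _∼₁_} {_≈_ = _≈₁_} weight-shift₁
         (Pointwise.++⁺ (Pointwise.replicate⁺ deferred a)
           (top-zero ∷ Pointwise.++⁺ (applyUpTo-Pointwise top-suc k) (applyUpTo-Pointwise bot m)))
         (Pointwise.++⁺ (Pointwise.replicate⁺ free a)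
           (large-zero ∷ Pointwise.++⁺ (applyUpTo-Pointwise large-suc k) (applyUpTo-Pointwise small m))) ⟩
  per weight (D ++ mixed ∷ rows) (F ++ free ∷ columns)
    ≡⟨ per-↭ weight (↭.shift mixed D rows) (↭.shift free F columns) ⟩
  per weight (mixed ∷ D ++ rows) (free ∷ F ++ columns)
    ≡⟨ per-split-row weight {mixed} {deferred} {pooled} weight-mixed (D ++ rows) (free ∷ F ++ columns) ⟩
  bandPer k m (suc a) + per weight (pooled ∷ D ++ rows) (free ∷ F ++ columns)
    ≡⟨ ℕ.+-comm (bandPer k m (suc a)) _ ⟩
  per weight (pooled ∷ D ++ rows) (free ∷ F ++ columns) + bandPer k m (suc a)
    ≡⟨ cong (_+ bandPer k m (suc a)) (per-pooled (D ++ rows) a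
         (All.++⁺ (All.applyUpTo⁺₂ large k (λ _ → refl)) (All.applyUpTo⁺₂ small m (λ _ → refl)))) ⟩
  suc a * bandPer k m a + bandPer k m (suc a) ∎
  where
  D       = replicate a deferred
  F       = replicate a free
  rows    = tops k ++ bots m
  columns = larges k ++ smalls m

-- The state of the elimination of the lower staircase. The number of deferred rows equals that of
-- free and reserved columns together, so the matrix stays square when a free column is traded for a
-- reserved one.
lowerPer : ℕ → ℕ → ℕ → ℕ
lowerPer m c b = per weight (replicate (c + b) deferred ++ bots m) (replicate c free ++ replicate b reserved ++ smalls m)

data _∼₂_ : Row → Row → Set where
  deferred : deferred ∼₂ deferred
  bot-zero : bot 0 ∼₂ pooled
  bot-suc  : ∀ r → bot (suc r) ∼₂ bot r

data _≈₂_ : Col → Col → Set where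
  free       : free ≈₂ free
  reserved   : reserved ≈₂ reserved
  small-zero : small 0 ≈₂ either
  small-suc  : ∀ y → small (suc y) ≈₂ small y

weight-shift₂ : ∀ {r r′ c c′} → r ∼₂ r′ → c ≈₂ c′ → weight r c ≡ weight r′ c′
weight-shift₂ deferred    free          = refl
weight-shift₂ deferred    reserved      = refl
weight-shift₂ deferred    small-zero    = refl
weight-shift₂ deferred    (small-suc y) = refl
weight-shift₂ bot-zero    free          = refl
weight-shift₂ bot-zero    reserved      = refl
weight-shift₂ bot-zero    small-zero    = refl
weight-shift₂ bot-zero    (small-suc y) = refl
weight-shift₂ (bot-suc r) free          = refl
weight-shift₂ (bot-suc r) reserved      = refl
weight-shift₂ (bot-suc r) small-zero    = refl
weight-shift₂ (bot-suc r) (small-suc y) = refl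

reserved-smalls-0 : ∀ b m → All (λ x → weight pooled x ≡ 0) (replicate b reserved ++ smalls m)
reserved-smalls-0 b m = All.++⁺ (All.replicate⁺ b refl) (All.applyUpTo⁺₂ small m (λ _ → refl))

-- Dual to `bandPer-suc`, with a column split in place of a row. The corner column `small 0` meets
-- all bottom and all deferred rows: it becomes a free column if a bottom row is to use it, and a
-- reserved one if a deferred row is. The corner row `bot 0` is left with the free columns and this
-- one.
lowerPer-split : ∀ m c b → lowerPer (suc m) c b ≡ suc c * lowerPer m c b ℕ.+
  per weight (pooled ∷ replicate (c + b) deferred ++ bots m) (reserved ∷ replicate c free ++ replicate b reserved ++ smalls m)
lowerPer-split m c b = begin
  lowerPer (suc m) c b
    ≡⟨ per-Pointwise {_∼_ = _∼₂_} {_≈_ = _≈₂_} weight-shift₂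
         (Pointwise.++⁺ (Pointwise.replicate⁺ deferred (c + b)) (bot-zero ∷ applyUpTo-Pointwise bot-suc m))
         (Pointwise.++⁺ (Pointwise.replicate⁺ free c)
           (Pointwise.++⁺ (Pointwise.replicate⁺ reserved b) (small-zero ∷ applyUpTo-Pointwise small-suc m))) ⟩
  per weight (D ++ pooled ∷ bots m) (F ++ Rs ++ either ∷ smalls m)
    ≡⟨ per-↭ weight (↭.shift pooled D (bots m))
         (↭-trans (↭.++⁺ˡ F (↭.shift either Rs (smalls m))) (↭.shift either F (Rs ++ smalls m))) ⟩
  per weight (pooled ∷ D ++ bots m) (either ∷ F ++ Rs ++ smalls m)
    ≡⟨ per-split-column weight {either} {free} {reserved} weight-either (pooled ∷ D ++ bots m) (F ++ Rs ++ smalls m) ⟩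
  per weight (pooled ∷ D ++ bots m) (free ∷ F ++ Rs ++ smalls m) + rest
    ≡⟨ cong (_+ rest) (per-pooled (D ++ bots m) c (reserved-smalls-0 b m)) ⟩
  suc c * lowerPer m c b + rest ∎
  where
  D    = replicate (c + b) deferred
  F    = replicate c free
  Rs   = replicate b reserved
  rest = per weight (pooled ∷ D ++ bots m) (reserved ∷ F ++ Rs ++ smalls m)

lowerPer-suc-zero : ∀ m b → lowerPer (suc m) 0 b ≡ lowerPer m 0 b
lowerPer-suc-zero m b = begin
  lowerPer (suc m) 0 b
    ≡⟨ lowerPer-split m 0 b ⟩
  1 * lowerPer m 0 b + per weight (pooled ∷ replicate b deferred ++ bots m) (replicate (suc b) reserved ++ smalls m)
    ≡⟨ cong (1 * lowerPer m 0 b ℕ.+_)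
         (pickSum-weight-0 (weight pooled) (per weight (replicate b deferred ++ bots m)) (reserved-smalls-0 (suc b) m)) ⟩
  1 * lowerPer m 0 b + 0
    ≡⟨ trans (ℕ.+-identityʳ _) (ℕ.*-identityˡ _) ⟩
  lowerPer m 0 b ∎

lowerPer-suc-suc : ∀ m c b → lowerPer (suc m) (suc c) b ≡
  suc (suc c) * lowerPer m (suc c) b + suc c * lowerPer m c (suc b)
lowerPer-suc-suc m c b = trans (lowerPer-split m (suc c) b) (cong (suc (suc c) * lowerPer m (suc c) b ℕ.+_) (begin
  per weight (pooled ∷ D ++ bots m) (reserved ∷ F ++ Rs ++ smalls m)
    ≡⟨ per-↭-columns weight (pooled ∷ D ++ bots m) (↭-sym (↭.shift reserved F (Rs ++ smalls m))) ⟩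
  per weight (pooled ∷ D ++ bots m) (F ++ reserved ∷ Rs ++ smalls m)
    ≡⟨ per-pooled (D ++ bots m) c (reserved-smalls-0 (suc b) m) ⟩
  suc c * per weight (D ++ bots m) (replicate c free ++ reserved ∷ Rs ++ smalls m)
    ≡⟨ cong (λ d → suc c * per weight (replicate d deferred ++ bots m) (replicate c free ++ reserved ∷ Rs ++ smalls m)) (sym (ℕ.+-suc c b)) ⟩
  suc c * lowerPer m c (suc b) ∎))
  where
  D  = replicate (suc c + b) deferred
  F  = replicate (suc c) free
  Rs = replicate b reserved

-- The factor `(c + b) !` counts the matchings of the deferred rows with the columns finally kept
-- for them. It is constant along the recurrence, because `c + b` is; what remains is the Stirling
-- recurrence multiplied by `c !`.
lowerPer-closed : ∀ m c b → lowerPer m c b ≡ c ! * S (suc m) (suc c) * (c + b) !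
lowerPer-closed zero zero b = trans (square b) (sym (ℕ.*-identityˡ (b !)))
  where
  square : ∀ b → per weight (replicate b deferred ++ []) (replicate b reserved ++ []) ≡ b !
  square zero    = refl
  square (suc b) = trans (pickSum-replicate (weight deferred) refl b (per weight (replicate b deferred ++ [])) [])
                           (cong (suc b *_) (square b))
lowerPer-closed zero (suc c) b = begin
  lowerPer 0 (suc c) b
    -- No bottom row is left to fill the free column, and deferred rows have weight 0 in it.
    ≡⟨ per-expand-column weight rows free columns ⟩
  pickSum (λ r rs → weight r free * per weight rs columns) rows
    ≡⟨ pickSum-weight-0 (λ r → weight r free) (λ rs → per weight rs columns) (All.++⁺ (All.replicate⁺ {x = deferred} (suc c + b) refl) []) ⟩
  0
    ≡⟨ cong (_* (suc c + b) !) (trans (cong (suc c ! *_) (S-vanishes {1} {suc (suc c)} (s≤s (s≤s z≤n)))) (ℕ.*-zeroʳ (suc c !))) ⟨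
  suc c ! * S 1 (suc (suc c)) * (suc c + b) ! ∎
  where
  rows    = replicate (suc c + b) deferred ++ bots 0
  columns = replicate c free ++ replicate b reserved ++ smalls 0
lowerPer-closed (suc m) zero b = begin
  lowerPer (suc m) 0 b                    ≡⟨ lowerPer-suc-zero m b ⟩
  lowerPer m 0 b                          ≡⟨ lowerPer-closed m 0 b ⟩
  1 * S (suc m) 1 * b !               ≡⟨ identity (S (suc m) 1) (b !) ⟩
  1 * (1 * S (suc m) 1 + 0) * b ! ∎
  where
  identity : ∀ s f → 1 * s * f ≡ 1 * (1 * s + 0) * f
  identity = ℕSolver.solve-∀
lowerPer-closed (suc m) (suc c) b = begin
  lowerPer (suc m) (suc c) b
    ≡⟨ lowerPer-suc-suc m c b ⟩
  suc (suc c) * lowerPer m (suc c) b + suc c * lowerPer m c (suc b)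
    ≡⟨ cong₂ (λ x y → suc (suc c) * x + suc c * y) (lowerPer-closed m (suc c) b) (lowerPer-closed m c (suc b)) ⟩
  suc (suc c) * (suc c * c ! * s * f) + suc c * (c ! * t * (c + suc b) !)
    ≡⟨ cong (λ d → suc (suc c) * (suc c * c ! * s * f) + suc c * (c ! * t * d !)) (ℕ.+-suc c b) ⟩
  suc (suc c) * (suc c * c ! * s * f) + suc c * (c ! * t * f)
    ≡⟨ identity (suc (suc c)) (suc c) (c !) s t f ⟩
  suc c * c ! * (suc (suc c) * s + t) * f ∎
  where
  f = (suc c + b) !
  s = S (suc m) (suc (suc c))
  t = S (suc m) (suc c)
  identity : ∀ i j p s t f → i * (j * p * s * f) + j * (p * t * f) ≡ j * p * (i * s + t) * f
  identity = ℕSolver.solve-∀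

bandPer-zero : ∀ m a → bandPer 0 m a ≡ S (suc m) (suc a) * (a ! * a !)
bandPer-zero m a = begin
  bandPer 0 m a
    ≡⟨ cong (λ d → per weight (replicate d deferred ++ bots m) (replicate a free ++ smalls m)) (ℕ.+-identityʳ a) ⟨
  lowerPer m a 0
    ≡⟨ lowerPer-closed m a 0 ⟩
  a ! * S (suc m) (suc a) * (a + 0) !
    ≡⟨ cong (λ d → a ! * S (suc m) (suc a) * d !) (ℕ.+-identityʳ a) ⟩
  a ! * S (suc m) (suc a) * a !
    ≡⟨ identity (a !) (S (suc m) (suc a)) ⟩
  S (suc m) (suc a) * (a ! * a !) ∎
  where
  identity : ∀ p s → p * s * p ≡ s * (p * p)
  identity = ℕSolver.solve-∀

-- An invariant of the elimination: `j` counts the corners already removed, and `S (suc j) (suc i)`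
-- is the coefficient with which `i` deferred rows occur after `j` removals. At `j = 0` a single
-- term remains, and at `k = 0` the closed form of the lower block applies.
Σ-bandPer : ∀ k j m →
  sumℤ j (λ i → + S (suc j) (suc i) ℤ.* + bandPer k m i) ≡ + stirlingSum (k + j) m
Σ-bandPer zero j m = trans
  (sumℤ-cong j (λ i → cong (λ x → + S (suc j) (suc i) ℤ.* + x) (bandPer-zero m i)))
  (sym (pos-stirlingSum j m))
Σ-bandPer (suc k) j m = begin
  sumℤ j (λ i → + S (suc j) (suc i) ℤ.* + bandPer (suc k) m i)
    ≡⟨ sumℤ-cong j (λ i → cong (+ S (suc j) (suc i) ℤ.*_) (pos i)) ⟩
  sumℤ j (λ i → + S (suc j) (suc i) ℤ.* (+ suc i ℤ.* + bandPer k m i ℤ.+ + bandPer k m (suc i)))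
    ≡⟨ Σ-S-suc-suc j (λ i → + bandPer k m i) ⟨
  sumℤ (suc j) (λ i → + S (suc (suc j)) (suc i) ℤ.* + bandPer k m i)
    ≡⟨ Σ-bandPer k (suc j) m ⟩
  + stirlingSum (k + suc j) m
    ≡⟨ cong (λ d → + stirlingSum d m) (ℕ.+-suc k j) ⟩
  + stirlingSum (suc k + j) m ∎
  where
  pos : ∀ i → + bandPer (suc k) m i ≡ + suc i ℤ.* + bandPer k m i ℤ.+ + bandPer k m (suc i)
  pos i = trans (cong +_ (bandPer-suc k m i))
    (trans (ℤ.pos-+ (suc i * bandPer k m i) _) (cong (ℤ._+ + bandPer k m (suc i)) (ℤ.pos-* (suc i) (bandPer k m i))))

bandPer-stirlingSum : ∀ k m → bandPer k m 0 ≡ stirlingSum k m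
bandPer-stirlingSum k m = ℤ.+-injective (begin
  + bandPer k m 0                ≡⟨ ℤ.*-identityˡ _ ⟨
  + 1 ℤ.* + bandPer k m 0        ≡⟨ Σ-bandPer k 0 m ⟩
  + stirlingSum (k + 0) m      ≡⟨ cong (λ d → + stirlingSum d m) (ℕ.+-identityʳ k) ⟩
  + stirlingSum k m              ∎)

-- Enumerating the permutations counted by a permanent

data Pick {A : Set} : List A → A → List A → Set where
  here  : ∀ {x xs} → Pick (x ∷ xs) x xs
  there : ∀ {x xs y ys} → Pick xs y ys → Pick (x ∷ xs) y (x ∷ ys)

pickCat : {A B : Set} → (A → List A → List B) → List A → List B
pickCat F []       = []
pickCat F (x ∷ xs) = F x xs ++ pickCat (λ y ys → F y (x ∷ ys)) xs

module _ {A : Set} where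

  Pick⇒∈ : ∀ {x : A} {xs ys} → Pick xs x ys → x ∈ xs
  Pick⇒∈ here      = here refl
  Pick⇒∈ (there p) = there (Pick⇒∈ p)

  ∈⇒Pick : ∀ {x : A} {xs} → x ∈ xs → Σ (List A) (Pick xs x)
  ∈⇒Pick (here refl) = _ , here
  ∈⇒Pick (there x∈)  with ys , p ← ∈⇒Pick x∈ = _ , there p

  Pick-length : ∀ {x : A} {xs ys} → Pick xs x ys → length xs ≡ suc (length ys)
  Pick-length here      = refl
  Pick-length (there p) = cong suc (Pick-length p)

  Pick-⊆ : ∀ {x y : A} {xs ys} → Pick xs x ys → y ∈ ys → y ∈ xs
  Pick-⊆ here      y∈          = there y∈
  Pick-⊆ (there p) (here refl) = here refl
  Pick-⊆ (there p) (there y∈)  = there (Pick-⊆ p y∈)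

  Pick-remaining : ∀ {x y : A} {xs ys} → Pick xs x ys → y ∈ xs → y ≢ x → y ∈ ys
  Pick-remaining here      (here refl) y≢x = contradiction refl y≢x
  Pick-remaining here      (there y∈)  y≢x = y∈
  Pick-remaining (there p) (here refl) y≢x = here refl
  Pick-remaining (there p) (there y∈)  y≢x = there (Pick-remaining p y∈ y≢x)

  Pick-Unique : ∀ {x : A} {xs ys} → Pick xs x ys → Unique xs → Unique ys
  Pick-Unique here      (_ ∷ u)  = u
  Pick-Unique (there p) (x∉ ∷ u) = All.tabulate (λ y∈ → All.lookup x∉ (Pick-⊆ p y∈)) ∷ Pick-Unique p u

  Pick-∉ : ∀ {x y : A} {xs ys} → Pick xs x ys → Unique xs → y ∈ ys → x ≢ y
  Pick-∉ here      (x∉ ∷ _) y∈          = All.lookup x∉ y∈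
  Pick-∉ (there p) (x∉ ∷ _) (here refl) = ≢-sym (All.lookup x∉ (Pick⇒∈ p))
  Pick-∉ (there p) (_ ∷ u)  (there y∈)  = Pick-∉ p u y∈

module _ {A B : Set} where

  length-pickCat : ∀ (F : A → List A → List B) xs → length (pickCat F xs) ≡ pickSum (λ x ys → length (F x ys)) xs
  length-pickCat F []       = refl
  length-pickCat F (x ∷ xs) = trans (List.length-++ (F x xs)) (cong (length (F x xs) ℕ.+_) (length-pickCat _ xs))

  ∈-pickCat⁻ : ∀ (F : A → List A → List B) xs {v} → v ∈ pickCat F xs →
    ∃₂ λ x ys → Pick xs x ys × v ∈ F x ys
  ∈-pickCat⁻ F (x ∷ xs) v∈ with ∈.∈-++⁻ (F x xs) v∈
  ... | inj₁ v∈F = x , xs , here , v∈F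
  ... | inj₂ v∈′ with y , ys , p , v∈F ← ∈-pickCat⁻ _ xs v∈′ = y , x ∷ ys , there p , v∈F

  ∈-pickCat⁺ : ∀ (F : A → List A → List B) {xs x ys v} → Pick xs x ys → v ∈ F x ys → v ∈ pickCat F xs
  ∈-pickCat⁺ F here                           v∈ = ∈.∈-++⁺ˡ v∈
  ∈-pickCat⁺ F {x ∷ xs} (there p) v∈ = ∈.∈-++⁺ʳ (F x xs) (∈-pickCat⁺ (λ y ys → F y (x ∷ ys)) p v∈)

  -- The function `h` recovers the chosen entry from the output, so the pieces belonging to
  -- different choices are disjoint.
  pickCat-Unique : ∀ (F : A → List A → List B) (h : B → A) {xs} → Unique xs →
    (∀ {x ys} → Pick xs x ys → Unique (F x ys)) → (∀ {x ys v} → v ∈ F x ys → h v ≡ x) →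
    Unique (pickCat F xs)
  pickCat-Unique F h []               uF hF = []
  pickCat-Unique F h {x ∷ xs} (x∉ ∷ u) uF hF = Unique.++⁺ (uF here)
    (pickCat-Unique (λ y ys → F y (x ∷ ys)) h u (uF ∘ there) hF)
    (λ (v∈ , v∈′) → let y , ys , p , v∈F = ∈-pickCat⁻ (λ y ys → F y (x ∷ ys)) xs v∈′ in
      All.lookup x∉ (Pick⇒∈ p) (trans (sym (hF v∈)) (hF v∈F)))

Distinct : ∀ {C : Set} {l} → Vec C l → Set
Distinct v = ∀ i j → lookup v i ≡ lookup v j → i ≡ j

module _ {R C : Set} {Ok : R → C → Set} (ok? : ∀ r c → Dec (Ok r c)) where

  indicator : R → C → ℕ
  indicator r c = if does (ok? r c) then 1 else 0

  -- The same recursion as `per`, with sums replaced by concatenations and factors 0 and 1 by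
  -- discarding or prefixing, so that lengths match permanents step by step.
  enum : ∀ l → (Fin l → R) → List C → List (Vec C l)
  extend : ∀ l → (Fin (suc l) → R) → C → List C → List (Vec C (suc l))

  enum zero    f []      = [] ∷ []
  enum zero    f (_ ∷ _) = []
  enum (suc l) f cs      = pickCat (extend l f) cs

  extend l f c cs = if does (ok? (f zero) c) then map (c ∷_) (enum l (f ∘ suc) cs) else []

  length-enum : ∀ l f cs → length (enum l f cs) ≡ per indicator (tabulate f) cs
  length-enum zero    f []      = refl
  length-enum zero    f (_ ∷ _) = refl
  length-enum (suc l) f cs      = trans (length-pickCat (extend l f) cs) (pickSum-cong length-extend cs)
    where
    length-extend : ∀ c cs′ → length (extend l f c cs′) ≡ indicator (f zero) c * per indicator (tabulate (f ∘ suc)) cs′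
    length-extend c cs′ with ok? (f zero) c
    ... | yes _ = trans (List.length-map (c ∷_) (enum l (f ∘ suc) cs′))
                    (trans (length-enum l (f ∘ suc) cs′) (sym (ℕ.*-identityˡ _)))
    ... | no  _ = refl

  ∈-extend⁻ : ∀ l f c cs {v} → v ∈ extend l f c cs →
    Ok (f zero) c × Σ (Vec C l) λ v′ → v ≡ c ∷ v′ × v′ ∈ enum l (f ∘ suc) cs
  ∈-extend⁻ l f c cs v∈ with ok? (f zero) c
  ... | yes ok with v′ , v′∈ , eq ← ∈.∈-map⁻ (c ∷_) v∈ = ok , v′ , eq , v′∈
  ... | no  _  with () ← v∈

  ∈-extend⁺ : ∀ l f c cs {v} → Ok (f zero) c → v ∈ enum l (f ∘ suc) cs → c ∷ v ∈ extend l f c cs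
  ∈-extend⁺ l f c cs ok v∈ with ok? (f zero) c
  ... | yes _  = ∈.∈-map⁺ (c ∷_) v∈
  ... | no ¬ok = contradiction ok ¬ok

  enum-sound : ∀ l f {cs v} → Unique cs → v ∈ enum l f cs →
    Distinct v × (∀ i → lookup v i ∈ cs) × (∀ i → Ok (f i) (lookup v i))
  enum-sound zero    f {v = []} u v∈ = (λ ()) , (λ ()) , λ ()
  enum-sound (suc l) f {cs} u v∈
    with c , cs′ , p , v∈F ← ∈-pickCat⁻ (extend l f) cs v∈
    with ok , v′ , refl , v′∈ ← ∈-extend⁻ l f c cs′ v∈F
    with inj , mem , oks ← enum-sound l (f ∘ suc) (Pick-Unique p u) v′∈
    = inj′ , mem′ , λ { zero → ok ; (suc i) → oks i }
    where
    mem′ : ∀ i → lookup (c ∷ v′) i ∈ cs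
    mem′ zero    = Pick⇒∈ p
    mem′ (suc i) = Pick-⊆ p (mem i)

    inj′ : Distinct (c ∷ v′)
    inj′ zero    zero    eq = refl
    inj′ zero    (suc j) eq = contradiction eq (Pick-∉ p u (mem j))
    inj′ (suc i) zero    eq = contradiction (sym eq) (Pick-∉ p u (mem i))
    inj′ (suc i) (suc j) eq = cong suc (inj i j eq)

  -- The length condition makes rows and columns run out together: `enum zero` yields nothing while
  -- columns are left over.
  enum-complete : ∀ l f {cs} {v : Vec C l} → length cs ≡ l → Distinct v →
    (∀ i → lookup v i ∈ cs) → (∀ i → Ok (f i) (lookup v i)) → v ∈ enum l f cs
  enum-complete zero    f {[]}     {[]}    _   _   _   _   = here refl
  enum-complete (suc l) f {cs}     {c ∷ v} len inj mem oks with cs′ , p ← ∈⇒Pick (mem zero) =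
    ∈-pickCat⁺ (extend l f) p (∈-extend⁺ l f c cs′ (oks zero)
      (enum-complete l (f ∘ suc) (ℕ.suc-injective (trans (sym (Pick-length p)) len))
        (λ i j eq → Fin.suc-injective (inj (suc i) (suc j) eq))
        (λ i → Pick-remaining p (mem (suc i)) (λ eq → contradiction (inj (suc i) zero eq) λ ()))
        (oks ∘ suc)))

  enum-Unique : ∀ l f {cs} → Unique cs → Unique (enum l f cs)
  enum-Unique zero    f {[]}    u = [] ∷ []
  enum-Unique zero    f {_ ∷ _} u = []
  enum-Unique (suc l) f         u = pickCat-Unique (extend l f) Vec.head u unique head-extend
    where
    unique : ∀ {c cs′} → Pick _ c cs′ → Unique (extend l f c cs′)
    unique {c} p with ok? (f zero) c
    ... | yes _ = Unique.map⁺ Vec.∷-injectiveʳ (enum-Unique l (f ∘ suc) (Pick-Unique p u))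
    ... | no  _ = []

    head-extend : ∀ {c cs′ v} → v ∈ extend l f c cs′ → Vec.head v ≡ c
    head-extend {c} {cs′} v∈ with _ , _ , refl , _ ← ∈-extend⁻ l f c cs′ v∈ = refl

card-permanent : ∀ {n} {Ok : Fin n → Fin n → Set} (ok? : ∀ p q → Dec (Ok p q)) →
  HasCard {Word n} (λ v → Distinct v × ∀ p → Ok p (lookup v p)) (per (indicator ok?) (allFin n) (allFin n))
card-permanent {n} ok? =
    enum ok? n id (allFin n)
  , enum-Unique ok? n id (Unique.allFin⁺ n)
  , (λ v → mk⇔
      (λ v∈ → let inj , _ , oks = enum-sound ok? n id (Unique.allFin⁺ n) v∈ in inj , oks)
      (λ (inj , oks) → enum-complete ok? n id (List.length-tabulate id) inj (λ i → ∈.∈-allFin (lookup v i)) oks))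
  , length-enum ok? n id (allFin n)

-- Identifying the band with the block matrix

Band : ℕ → ℕ → ∀ {n} → Fin n → Fin n → Set
Band k m p q = toℕ q ≤ toℕ p + m × toℕ p ≤ toℕ q + k

band? : ∀ k m {n} (p q : Fin n) → Dec (Band k m p q)
band? k m p q = (toℕ q ℕ.≤? toℕ p + m) ×-dec (toℕ p ℕ.≤? toℕ q + k)

leq-true : ∀ {a b} → a ≤ b → leq a b ≡ 1
leq-true z≤n       = refl
leq-true (s≤s a≤b) = leq-true a≤b

leq-false : ∀ {a b} → b < a → leq a b ≡ 0
leq-false {suc a} {zero}  _         = refl
leq-false {suc a} {suc b} (s≤s b<a) = leq-false b<a

indicator-true : ∀ {P : Set} (d : Dec P) → P → (if does d then 1 else 0) ≡ 1
indicator-true d p = cong (if_then 1 else 0) (dec-true d p)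

indicator-leq : ∀ {P : Set} (d : Dec P) {a b} → (a ≤ b → P) → (P → a ≤ b) → (if does d then 1 else 0) ≡ leq a b
indicator-leq (yes p) from to = sym (leq-true (to p))
indicator-leq (no ¬p) from to = sym (leq-false (ℕ.≰⇒> (¬p ∘ from)))

-- The bottom rows and the small columns are listed from the last to the first.
data RowAt (k m : ℕ) {n} (i : Fin n) : Row → Set where
  top : ∀ {p} → p < k → toℕ i ≡ p → RowAt k m i (top p)
  bot : ∀ {r} → r < m → toℕ i + suc r ≡ k + m → RowAt k m i (bot r)

data ColAt (k m : ℕ) {n} (j : Fin n) : Col → Set where
  small : ∀ {y} → y < m → toℕ j + suc y ≡ m → ColAt k m j (small y)
  large : ∀ {s} → s < k → toℕ j ≡ m + s → ColAt k m j (large s)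

-- In the blocks top/small and bottom/large both band inequalities hold automatically. In each of
-- the other two blocks one inequality is automatic and the other is the staircase; the reversed
-- numbering of bottom rows and small columns gives the second staircase the same form as the first.
indicator-weight : ∀ {k m n} {i j : Fin n} {r c} → RowAt k m i r → ColAt k m j c →
  indicator (band? k m) i j ≡ weight r c
indicator-weight {k} {m} {i = i} {j} (top {p} p<k i≡p) (small {y} y<m j+y≡m) =
  indicator-true (band? k m i j)
    ( ℕ.≤-trans (ℕ.m+n≤o⇒m≤o (toℕ j) (ℕ.≤-reflexive j+y≡m)) (ℕ.m≤n+m m (toℕ i))
    , ℕ.≤-trans (ℕ.≤-reflexive i≡p) (ℕ.≤-trans (ℕ.<⇒≤ p<k) (ℕ.m≤n+m k (toℕ j))))
indicator-weight {k} {m} {i = i} {j} (top {p} p<k i≡p) (large {s} s<k j≡m+s) =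
  indicator-leq (band? k m i j)
    (λ s≤p →
        ℕ.≤-trans (ℕ.≤-reflexive (trans j≡m+s (ℕ.+-comm m s))) (ℕ.+-monoˡ-≤ m (ℕ.≤-trans s≤p (ℕ.≤-reflexive (sym i≡p))))
      , ℕ.≤-trans (ℕ.≤-reflexive i≡p) (ℕ.≤-trans (ℕ.<⇒≤ p<k) (ℕ.m≤n+m k (toℕ j))))
    (λ (j≤ , _) → ℕ.+-cancelʳ-≤ m s p (subst₂ _≤_ (trans j≡m+s (ℕ.+-comm m s)) (cong (_+ m) i≡p) j≤))
indicator-weight {k} {m} {i = i} {j} (bot {r} r<m i+r≡k+m) (small {y} y<m j+y≡m) =
  indicator-leq (band? k m i j)
    (λ y≤r →
        ℕ.≤-trans (ℕ.m+n≤o⇒m≤o (toℕ j) (ℕ.≤-reflexive j+y≡m)) (ℕ.m≤n+m m (toℕ i))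
      , ℕ.+-cancelʳ-≤ (suc r) (toℕ i) (toℕ j + k)
          (ℕ.≤-trans (ℕ.≤-reflexive i+r≡j+k+y) (ℕ.+-monoʳ-≤ (toℕ j + k) (s≤s y≤r))))
    (λ (_ , i≤) → ℕ.s≤s⁻¹ (ℕ.+-cancelˡ-≤ (toℕ j + k) (suc y) (suc r)
          (ℕ.≤-trans (ℕ.≤-reflexive (sym i+r≡j+k+y)) (ℕ.+-monoˡ-≤ (suc r) i≤))))
  where
  i+r≡j+k+y : toℕ i + suc r ≡ toℕ j + k + suc y
  i+r≡j+k+y = begin
    toℕ i + suc r       ≡⟨ i+r≡k+m ⟩
    k + m               ≡⟨ cong (k ℕ.+_) j+y≡m ⟨
    k + (toℕ j + suc y) ≡⟨ ℕ.+-assoc k (toℕ j) (suc y) ⟨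
    k + toℕ j + suc y   ≡⟨ cong (_+ suc y) (ℕ.+-comm k (toℕ j)) ⟩
    toℕ j + k + suc y   ∎
indicator-weight {k} {m} {i = i} {j} (bot {r} r<m i+r≡k+m) (large {s} s<k j≡m+s) =
  indicator-true (band? k m i j)
    ( ℕ.≤-trans (ℕ.≤-reflexive (trans j≡m+s (ℕ.+-comm m s))) (ℕ.+-monoˡ-≤ m (ℕ.≤-trans (ℕ.<⇒≤ s<k) k≤i))
    , ℕ.≤-trans (ℕ.m+n≤o⇒m≤o (toℕ i) (ℕ.≤-reflexive (trans i+r≡k+m (ℕ.+-comm k m))))
        (ℕ.+-monoˡ-≤ k (ℕ.≤-trans (ℕ.m≤m+n m s) (ℕ.≤-reflexive (sym j≡m+s)))))
  where
  k≤i : k ≤ toℕ i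
  k≤i = ℕ.+-cancelʳ-≤ (suc r) k (toℕ i) (ℕ.≤-trans (ℕ.+-monoʳ-≤ k r<m) (ℕ.≤-reflexive (sym i+r≡k+m)))

tabulate-+ : ∀ {A : Set} a {b} (f : Fin (a + b) → A) →
  tabulate f ≡ tabulate (λ i → f (i ↑ˡ b)) ++ tabulate (λ i → f (a ↑ʳ i))
tabulate-+ zero    f = refl
tabulate-+ (suc a) f = cong (f zero ∷_) (tabulate-+ a (f ∘ suc))

module _ {A B : Set} {_∼_ : A → B → Set} where

  tabulate-applyUpTo : ∀ {l} {f : Fin l → A} {g : ℕ → B} → (∀ i → f i ∼ g (toℕ i)) →
    Pointwise _∼_ (tabulate f) (applyUpTo g l)
  tabulate-applyUpTo {zero}  eq = []
  tabulate-applyUpTo {suc l} eq = eq zero ∷ tabulate-applyUpTo (eq ∘ suc)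

  tabulate-applyDownFrom : ∀ {l} {f : Fin l → A} {g : ℕ → B} → (∀ i r → toℕ i + suc r ≡ l → f i ∼ g r) →
    Pointwise _∼_ (tabulate f) (applyDownFrom g l)
  tabulate-applyDownFrom {zero}  eq = []
  tabulate-applyDownFrom {suc l} eq = eq zero l refl ∷ tabulate-applyDownFrom (λ i r e → eq (suc i) r (cong suc e))

applyDownFrom-↭ : ∀ {A : Set} (f : ℕ → A) l → applyDownFrom f l ↭ applyUpTo f l
applyDownFrom-↭ f zero    = Perm.refl
applyDownFrom-↭ f (suc l) = ↭-trans (Perm.prep (f l) (applyDownFrom-↭ f l))
  (↭-trans (↭.∷↭∷ʳ (f l) (applyUpTo f l)) (↭-reflexive (List.applyUpTo-∷ʳ f l)))

rowsAt : ∀ k m → Pointwise (RowAt k m) (allFin (k + m)) (tops k ++ applyDownFrom bot m)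
rowsAt k m = subst (λ is → Pointwise (RowAt k m) is (tops k ++ applyDownFrom bot m)) (sym (tabulate-+ k id))
  (Pointwise.++⁺
    (tabulate-applyUpTo (λ i → top (Fin.toℕ<n i) (Fin.toℕ-↑ˡ i m)))
    (tabulate-applyDownFrom (λ i r e → bot (ℕ.m+n≤o⇒n≤o (toℕ i) (ℕ.≤-reflexive e))
      (trans (cong (_+ suc r) (Fin.toℕ-↑ʳ k i)) (trans (ℕ.+-assoc k (toℕ i) (suc r)) (cong (k ℕ.+_) e))))))

-- Rows split as `k + m` but columns as `m + k`; the equation for `n` reconciles the two.
colsAt : ∀ k m {n} → n ≡ m + k → Pointwise (ColAt k m) (allFin n) (applyDownFrom small m ++ larges k)
colsAt k m refl = subst (λ is → Pointwise (ColAt k m) is (applyDownFrom small m ++ larges k)) (sym (tabulate-+ m id))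
  (Pointwise.++⁺
    (tabulate-applyDownFrom (λ i r e → small (ℕ.m+n≤o⇒n≤o (toℕ i) (ℕ.≤-reflexive e))
      (trans (cong (_+ suc r) (Fin.toℕ-↑ˡ i k)) e)))
    (tabulate-applyUpTo (λ i → large (Fin.toℕ<n i) (Fin.toℕ-↑ʳ m i))))

per-band : ∀ k m → per (indicator (band? k m)) (allFin (k + m)) (allFin (k + m)) ≡ stirlingSum k m
per-band k m = begin
  per (indicator (band? k m)) (allFin (k + m)) (allFin (k + m))
    ≡⟨ per-Pointwise {_∼_ = RowAt k m} {_≈_ = ColAt k m} indicator-weight (rowsAt k m) (colsAt k m (ℕ.+-comm k m)) ⟩
  per weight (tops k ++ applyDownFrom bot m) (applyDownFrom small m ++ larges k)
    ≡⟨ per-↭ weight (↭.++⁺ˡ (tops k) (applyDownFrom-↭ bot m))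
         (↭-trans (↭.++-comm (applyDownFrom small m) (larges k)) (↭.++⁺ˡ (larges k) (applyDownFrom-↭ small m))) ⟩
  bandPer k m 0
    ≡⟨ bandPer-stirlingSum k m ⟩
  stirlingSum k m ∎

card-band : ∀ k m → HasCard {Word (k + m)} (λ v → Distinct v × ∀ p → Band k m p (lookup v p)) (stirlingSum k m)
card-band k m = subst (HasCard _) (per-band k m) (card-permanent (band? k m))

-- Sums indexed by `Fin n`

sum-mono-≤ : ∀ {n} {f g : Fin n → ℕ} → (∀ i → f i ≤ g i) → sum f ≤ sum g
sum-mono-≤ {zero}  f≤g = z≤n
sum-mono-≤ {suc n} f≤g = ℕ.+-mono-≤ (f≤g zero) (sum-mono-≤ (f≤g ∘ suc))

sum-mono-< : ∀ {n} {f g : Fin n → ℕ} → (∀ i → f i ≤ g i) → ∀ i → f i < g i → sum f < sum g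
sum-mono-< f≤g zero    lt = ℕ.+-mono-<-≤ lt (sum-mono-≤ (f≤g ∘ suc))
sum-mono-< f≤g (suc i) lt = ℕ.+-mono-≤-< (f≤g zero) (sum-mono-< (f≤g ∘ suc) i lt)

sum-≤-* : ∀ {n} {f : Fin n → ℕ} c → (∀ i → f i ≤ c) → sum f ≤ n * c
sum-≤-* {zero}  c f≤c = z≤n
sum-≤-* {suc n} c f≤c = ℕ.+-mono-≤ (f≤c zero) (sum-≤-* c (f≤c ∘ suc))

sum₂ : ∀ {n} → (Fin n → Fin n → ℕ) → ℕ
sum₂ F = sum (λ a → sum (F a))

sum₂-cong : ∀ {n} {F G : Fin n → Fin n → ℕ} → (∀ a b → F a b ≡ G a b) → sum₂ F ≡ sum₂ G
sum₂-cong eq = sum-cong-≗ (λ a → sum-cong-≗ (eq a))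

sum₂-+ : ∀ {n} (F G : Fin n → Fin n → ℕ) → sum₂ (λ a b → F a b + G a b) ≡ sum₂ F + sum₂ G
sum₂-+ F G = trans (sum-cong-≗ (λ a → ∑-distrib-+ (F a) (G a))) (∑-distrib-+ (sum ∘ F) (sum ∘ G))

listSum-tabulate : ∀ {A : Set} {n} (f : A → ℕ) (g : Fin n → A) →
  List.foldr _+_ 0 (map f (Vec.toList (Vec.tabulate g))) ≡ sum (f ∘ g)
listSum-tabulate {n = zero}  f g = refl
listSum-tabulate {n = suc n} f g = cong (f (g zero) ℕ.+_) (listSum-tabulate f (g ∘ suc))

listSum-cartesianProduct : ∀ {A B : Set} {l n} (f : A × B → ℕ) (g : Fin l → A) (h : Fin n → B) →
  List.foldr _+_ 0 (map f (cartesianProduct (Vec.toList (Vec.tabulate g)) (Vec.toList (Vec.tabulate h))))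
    ≡ sum (λ a → sum (λ b → f (g a , h b)))
listSum-cartesianProduct {l = zero}  f g h = refl
listSum-cartesianProduct {l = suc l} f g h = begin
  total (map f (map (g zero ,_) hs List.++ rest))
    ≡⟨ cong total (List.map-++ f (map (g zero ,_) hs) rest) ⟩
  total (map f (map (g zero ,_) hs) List.++ map f rest)
    ≡⟨ sum-++ (map f (map (g zero ,_) hs)) (map f rest) ⟩
  total (map f (map (g zero ,_) hs)) + total (map f rest)
    ≡⟨ cong₂ _+_
         (trans (cong total (sym (List.map-∘ hs))) (listSum-tabulate (λ y → f (g zero , y)) h))
         (listSum-cartesianProduct f (g ∘ suc) h) ⟩
  sum (λ a → sum (λ b → f (g a , h b))) ∎
  where
  total = List.foldr _+_ 0
  hs    = Vec.toList (Vec.tabulate h)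
  rest  = cartesianProduct (Vec.toList (Vec.tabulate (g ∘ suc))) hs

-- Inversions

lt : ℕ → ℕ → ℕ
lt a b = if a <ᵇ b then 1 else 0

lt-true : ∀ {a b} → a < b → lt a b ≡ 1
lt-true {a} {b} a<b with a <ᵇ b | ℕ.<⇒<ᵇ a<b
... | true | _ = refl

lt-false : ∀ {a b} → b ≤ a → lt a b ≡ 0
lt-false {a} {b} b≤a with a <ᵇ b in eq
... | false = refl
... | true  = contradiction (ℕ.<ᵇ⇒< a b (subst T (sym eq) tt)) (ℕ.≤⇒≯ b≤a)

lt-≤1 : ∀ a b → lt a b ≤ 1
lt-≤1 a b with a <ᵇ b
... | true  = s≤s z≤n
... | false = z≤n

lt-mono : ∀ {a b c d} → (a < b → c < d) → lt a b ≤ lt c d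
lt-mono {a} {b} {c} {d} imp with a ℕ.<? b
... | yes a<b = subst (lt a b ≤_) (sym (lt-true (imp a<b))) (lt-≤1 a b)
... | no  a≮b = subst (_≤ lt c d) (sym (lt-false (ℕ.≮⇒≥ a≮b))) z≤n

inversion : ∀ {n} → (Fin n → Fin n) → Fin n → Fin n → ℕ
inversion x a b = lt (toℕ a) (toℕ b) * lt (toℕ (x b)) (toℕ (x a))

inv-sum₂ : ∀ {n} (u : Word n) → inv u ≡ sum₂ (inversion (lookup u))
inv-sum₂ {n} u = trans (listSum-cartesianProduct {l = n} {n} _ id id)
  (sum₂-cong (λ a b → if-∧ (toℕ a <ᵇ toℕ b) (toℕ (lookup u b) <ᵇ toℕ (lookup u a))))
  where
  if-∧ : ∀ x y → (if x ∧ y then 1 else 0) ≡ (if x then 1 else 0) * (if y then 1 else 0)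
  if-∧ true  true  = refl
  if-∧ true  false = refl
  if-∧ false y     = refl

-- A crude ceiling, one for each ordered pair of positions, which makes the upward induction towards
-- `wmax` terminate.
inv-bounded : ∀ {n} (u : Word n) → inv u ≤ n * (n * 1)
inv-bounded {n} u = subst (_≤ n * (n * 1)) (sym (inv-sum₂ u))
  (sum-≤-* (n * 1) (λ a → sum-≤-* 1 (λ b → ℕ.*-mono-≤ (lt-≤1 (toℕ a) (toℕ b)) (lt-≤1 (toℕ (lookup u b)) (toℕ (lookup u a))))))

-- The two sides differ by the product (X - x)(Y - y).
rearrangement : ∀ {x X y Y} → x ≤ X → y ≤ Y → x * Y + X * y ≤ x * y + X * Y
rearrangement {x} {X} {y} {Y} x≤X y≤Y
  with d , refl ← ℕ.m≤n⇒∃[o]m+o≡n x≤X | e , refl ← ℕ.m≤n⇒∃[o]m+o≡n y≤Y =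
  subst (x * Y + X * y ≤_) (sym (identity x y d e)) (ℕ.m≤m+n _ (d * e))
  where
  identity : ∀ x y d e → x * y + (x + d) * (y + e) ≡ x * (y + e) + (x + d) * y + d * e
  identity = ℕSolver.solve-∀

-- The graph of the transposition as an inductive family: matching on it determines the argument and
-- its image at once.
data Transposed {n} (i j : Fin n) : Fin n → Fin n → Set where
  left  : Transposed i j i j
  right : Transposed i j j i
  fixed : ∀ {a} → a ≢ i → a ≢ j → Transposed i j a a

transposed : ∀ {n} (i j : Fin n) a → Transposed i j a (PC.transpose i j a)
transposed i j a with a Fin.≟ i
... | yes refl = left
... | no  a≢i with a Fin.≟ j
...   | yes refl = right
...   | no  a≢j = fixed a≢i a≢j

transposed-unique : ∀ {n} {i j a b c : Fin n} → i ≢ j → Transposed i j a b → Transposed i j a c → b ≡ c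
transposed-unique i≢j left          left          = refl
transposed-unique i≢j left          right         = contradiction refl i≢j
transposed-unique i≢j left          (fixed ≢i _)  = contradiction refl ≢i
transposed-unique i≢j right         left          = contradiction refl i≢j
transposed-unique i≢j right         right         = refl
transposed-unique i≢j right         (fixed _ ≢j)  = contradiction refl ≢j
transposed-unique i≢j (fixed ≢i _)  left          = contradiction refl ≢i
transposed-unique i≢j (fixed _ ≢j)  right         = contradiction refl ≢j
transposed-unique i≢j (fixed _ _)   (fixed _ _)   = refl

transposed-sym : ∀ {n} {i j a b : Fin n} → Transposed i j a b → Transposed i j b a
transposed-sym left          = right
transposed-sym right         = left
transposed-sym (fixed ≢i ≢j) = fixed ≢i ≢j

-- Averaging over the orbits of the transposition in both coordinates reduces the comparison of
-- inversion numbers to a pointwise one.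
module _ {n} (x : Fin n → Fin n) (i j : Fin n) (i<j : toℕ i < toℕ j) (xi<xj : toℕ (x i) < toℕ (x j)) where

  private
    A V : Fin n → Fin n → ℕ
    A a b = lt (toℕ a) (toℕ b)
    V a b = lt (toℕ (x b)) (toℕ (x a))

    -- Contributions of the orbit of a pair to the inversions of `x` and of `x` composed with the
    -- transposition. The factor `A` compares positions and `V` compares values; composing moves the
    -- arguments of `V` only.
    before after : Fin n → Fin n → Fin n → Fin n → ℕ
    before a a′ b b′ = A a b * V a b + A a′ b * V a′ b + (A a b′ * V a b′ + A a′ b′ * V a′ b′)
    after  a a′ b b′ = A a b * V a′ b′ + A a′ b * V a b′ + (A a b′ * V a′ b + A a′ b′ * V a b)

    data End : Fin n → Set where
      left  : End i
      right : End j

    ends : ∀ {a b} → End a → End b → A a b * V a b ≡ 0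
    ends left  left  = cong (_* V i i) (lt-false {toℕ i} ℕ.≤-refl)
    ends left  right = trans (cong (A i j *_) (lt-false (ℕ.<⇒≤ xi<xj))) (ℕ.*-zeroʳ (A i j))
    ends right left  = cong (_* V j i) (lt-false (ℕ.<⇒≤ i<j))
    ends right right = cong (_* V j j) (lt-false {toℕ j} ℕ.≤-refl)

    before-ends : ∀ {a a′ b b′} → End a → End a′ → End b → End b′ → before a a′ b b′ ≡ 0
    before-ends a a′ b b′ = cong₂ _+_ (cong₂ _+_ (ends a b) (ends a′ b)) (cong₂ _+_ (ends a b′) (ends a′ b′))

    -- For fixed `c` the position factors increase from `i` to `j` while the value factors decrease,
    -- so exchanging the value factors can only enlarge the sum.
    columns : ∀ c → A c i * V c i + A c j * V c j ≤ A c i * V c j + A c j * V c i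
    columns c = rearrangement (lt-mono {toℕ c} (λ c<i → ℕ.<-trans c<i i<j)) (lt-mono {b = toℕ (x c)} (λ xj<xc → ℕ.<-trans xi<xj xj<xc))

    rows : ∀ c → A j c * V j c + A i c * V i c ≤ A j c * V i c + A i c * V j c
    rows c = rearrangement (lt-mono {b = toℕ c} (λ j<c → ℕ.<-trans i<j j<c)) (lt-mono {toℕ (x c)} (λ xc<xi → ℕ.<-trans xc<xi xi<xj))

    double : ∀ p q r s → p + q ≤ r + s → p + p + (q + q) ≤ r + r + (s + s)
    double p q r s le = subst₂ _≤_ (exchange p q) (exchange r s) (ℕ.+-mono-≤ le le)
      where
      exchange : ∀ p q → p + q + (p + q) ≡ p + p + (q + q)
      exchange = ℕSolver.solve-∀

    flip : ∀ p q r s → p + q ≤ r + s → q + p ≤ s + r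
    flip p q r s = subst₂ _≤_ (ℕ.+-comm p q) (ℕ.+-comm r s)

    before≤after : ∀ {a a′ b b′} → Transposed i j a a′ → Transposed i j b b′ → before a a′ b b′ ≤ after a a′ b b′
    before≤after (fixed {c} _ _) (fixed _ _)     = ℕ.≤-refl
    before≤after (fixed {c} _ _) left            = double (A c i * V c i) (A c j * V c j) (A c i * V c j) (A c j * V c i) (columns c)
    before≤after (fixed {c} _ _) right           = double (A c j * V c j) (A c i * V c i) (A c j * V c i) (A c i * V c j)
      (flip (A c i * V c i) (A c j * V c j) (A c i * V c j) (A c j * V c i) (columns c))
    before≤after left            (fixed {c} _ _) = ℕ.+-mono-≤ le le
      where le = flip (A j c * V j c) (A i c * V i c) (A j c * V i c) (A i c * V j c) (rows c)
    before≤after right           (fixed {c} _ _) = ℕ.+-mono-≤ (rows c) (rows c)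
    before≤after left            left            = subst (_≤ after i j i j) (sym (before-ends left right left right)) z≤n
    before≤after left            right           = subst (_≤ after i j j i) (sym (before-ends left right right left)) z≤n
    before≤after right           left            = subst (_≤ after j i i j) (sym (before-ends right left left right)) z≤n
    before≤after right           right           = subst (_≤ after j i j i) (sym (before-ends right left right left)) z≤n

    -- The source of strictness: no pair within the positions `i` and `j` is inverted before the
    -- exchange, but the pair of `i` and `j` is afterwards.
    before<after : before i j j i < after i j j i
    before<after = subst₂ _<_ (sym (before-ends left right right left))
      (cong (λ z → z + A j j * V i i + (A i i * V j j + A j i * V i j))
        (sym (cong₂ _*_ (lt-true i<j) (lt-true xi<xj))))
      (s≤s z≤n)

    σ : Fin n → Fin n
    σ = PC.transpose i j

    σσ : ∀ a → σ (σ a) ≡ a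
    σσ a = transposed-unique (λ { refl → ℕ.<-irrefl refl i<j }) (transposed i j (σ a)) (transposed-sym (transposed i j a))

    spread : (F : Fin n → Fin n → ℕ) →
      sum₂ (λ a b → F a b + F (σ a) b + (F a (σ b) + F (σ a) (σ b))) ≡ 4 * sum₂ F
    spread F = begin
      sum₂ (λ a b → F a b + F (σ a) b + (F a (σ b) + F (σ a) (σ b)))
        ≡⟨ trans (sum₂-+ (λ a b → F a b + F (σ a) b) (λ a b → F a (σ b) + F (σ a) (σ b)))
             (cong₂ _+_ (sum₂-+ F (λ a b → F (σ a) b)) (sum₂-+ (λ a b → F a (σ b)) (λ a b → F (σ a) (σ b)))) ⟩
      sum₂ F + sum₂ (λ a b → F (σ a) b) + (sum₂ (λ a b → F a (σ b)) + sum₂ (λ a b → F (σ a) (σ b)))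
        ≡⟨ cong₂ (λ s t → sum₂ F + s + t) (outer F)
             (cong₂ _+_ (inner F) (trans (outer (λ a b → F a (σ b))) (inner F))) ⟩
      sum₂ F + sum₂ F + (sum₂ F + sum₂ F)
        ≡⟨ identity (sum₂ F) ⟩
      4 * sum₂ F ∎
      where
      identity : ∀ s → s + s + (s + s) ≡ 4 * s
      identity = ℕSolver.solve-∀
      outer : ∀ G → sum₂ (λ a b → G (σ a) b) ≡ sum₂ G
      outer G = sym (sum-permute (sum ∘ G) (transpose i j))
      inner : ∀ G → sum₂ (λ a b → G a (σ b)) ≡ sum₂ G
      inner G = sum-cong-≗ (λ a → sym (sum-permute (G a) (transpose i j)))

  inversions-transpose : sum₂ (inversion x) < sum₂ (inversion (x ∘ PC.transpose i j))
  inversions-transpose = ℕ.*-cancelˡ-< 4 _ _ (subst₂ _<_ (spread (inversion x)) averaged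
    (sum-mono-< (λ a → sum-mono-≤ (pointwise a)) i
      (sum-mono-< (pointwise i) j (subst₂ (λ s t → before i s j t < after i s j t) (sym σi) (sym σj) before<after))))
    where
    pointwise : ∀ a b → before a (σ a) b (σ b) ≤ after a (σ a) b (σ b)
    pointwise a b = before≤after (transposed i j a) (transposed i j b)

    i≢j : i ≢ j
    i≢j refl = ℕ.<-irrefl refl i<j

    σi : σ i ≡ j
    σi = transposed-unique i≢j (transposed i j i) left

    σj : σ j ≡ i
    σj = transposed-unique i≢j (transposed i j j) right

    averaged : sum₂ (λ a b → after a (σ a) b (σ b)) ≡ 4 * sum₂ (inversion (x ∘ σ))
    averaged = trans (sum₂-cong unfold) (spread (inversion (x ∘ σ)))
      where
      unfold : ∀ a b → after a (σ a) b (σ b) ≡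
        inversion (x ∘ σ) a b + inversion (x ∘ σ) (σ a) b + (inversion (x ∘ σ) a (σ b) + inversion (x ∘ σ) (σ a) (σ b))
      unfold a b rewrite σσ a | σσ b = refl

-- Exchanging two entries and the steps of the Bruhat order

lookup-ext : ∀ {A : Set} {n} {u v : Vec A n} → (∀ a → lookup u a ≡ lookup v a) → u ≡ v
lookup-ext {u = u} {v} eq = trans (sym (Vec.tabulate∘lookup u)) (trans (Vec.tabulate-cong eq) (Vec.tabulate∘lookup v))

module _ {n} (u : Word n) where

  lookup-swapAt : ∀ {i j a b} → i ≢ j → Transposed i j a b → lookup (swapAt i j u) a ≡ lookup u b
  lookup-swapAt {i} {j} i≢j left = trans
    (Vec.lookup∘update′ i≢j (u Vec.[ i ]≔ lookup u j) (lookup u i)) (Vec.lookup∘update i u (lookup u j))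
  lookup-swapAt {i} {j} i≢j right = Vec.lookup∘update j (u Vec.[ i ]≔ lookup u j) (lookup u i)
  lookup-swapAt {i} {j} i≢j (fixed a≢i a≢j) = trans
    (Vec.lookup∘update′ a≢j (u Vec.[ i ]≔ lookup u j) (lookup u i)) (Vec.lookup∘update′ a≢i u (lookup u j))

  swapAt-cong : ∀ {i j} → lookup u i ≡ lookup u j → swapAt i j u ≡ u
  swapAt-cong {i} {j} eq = trans (cong₂ (λ x y → (u Vec.[ i ]≔ x) Vec.[ j ]≔ y) (sym eq) eq)
    (trans (cong (Vec._[ j ]≔ lookup u j) (Vec.[]≔-lookup u i)) (Vec.[]≔-lookup u j))

  swapAt-comm : ∀ {i j} → i ≢ j → swapAt i j u ≡ swapAt j i u
  swapAt-comm i≢j = Vec.[]≔-commutes u _ _ i≢j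

  inv-swapAt : ∀ {i j} → toℕ i < toℕ j → toℕ (lookup u i) < toℕ (lookup u j) → inv u < inv (swapAt i j u)
  inv-swapAt {i} {j} i<j ui<uj = subst₂ _<_ (sym (inv-sum₂ u))
    (trans (sum₂-cong (λ a b → cong₂ (λ y z → lt (toℕ a) (toℕ b) * lt (toℕ y) (toℕ z)) (moved b) (moved a)))
      (sym (inv-sum₂ (swapAt i j u))))
    (inversions-transpose (lookup u) i j i<j ui<uj)
    where
    moved : ∀ a → lookup u (PC.transpose i j a) ≡ lookup (swapAt i j u) a
    moved a = sym (lookup-swapAt (λ { refl → ℕ.<-irrefl refl i<j }) (transposed i j a))

swapAt-involutive : ∀ {n} (u : Word n) {i j} → i ≢ j → swapAt i j (swapAt i j u) ≡ u
swapAt-involutive u {i} {j} i≢j = lookup-ext λ a →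
  trans (lookup-swapAt (swapAt i j u) i≢j (transposed i j a))
        (lookup-swapAt u i≢j (transposed-sym (transposed i j a)))

<⇒≢ : ∀ {n} {i j : Fin n} → toℕ i < toℕ j → i ≢ j
<⇒≢ i<j refl = ℕ.<-irrefl refl i<j

inv-swapAt-descent : ∀ {n} (u : Word n) {i j} → toℕ i < toℕ j → toℕ (lookup u j) < toℕ (lookup u i) →
  inv (swapAt i j u) < inv u
inv-swapAt-descent u {i} {j} i<j uj<ui =
  subst (inv (swapAt i j u) <_) (cong inv (swapAt-involutive u (<⇒≢ i<j)))
    (inv-swapAt (swapAt i j u) i<j
      (subst₂ _<_ (cong toℕ (sym (lookup-swapAt u (<⇒≢ i<j) left))) (cong toℕ (sym (lookup-swapAt u (<⇒≢ i<j) right))) uj<ui))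

swapAt-ascent : ∀ {n} (u : Word n) {i j} → toℕ i < toℕ j → inv u < inv (swapAt i j u) →
  toℕ (lookup u i) < toℕ (lookup u j)
swapAt-ascent u {i} {j} i<j inv< with ℕ.<-cmp (toℕ (lookup u i)) (toℕ (lookup u j))
... | tri< lt _ _ = lt
... | tri≈ _ eq _ = contradiction (cong inv (sym (swapAt-cong u (Fin.toℕ-injective eq)))) (ℕ.<⇒≢ inv<)
... | tri> _ _ gt = contradiction inv< (ℕ.<-asym (inv-swapAt-descent u i<j gt))

-- A step of `≤B` names its positions in any order and does not exclude `i = j`. The growth of `inv`
-- rules out equality, and `swapAt` is symmetric, so every step is the exchange of an ascent.
step-ascent : ∀ {n} (u : Word n) i j → inv u < inv (swapAt i j u) →
  ∃₂ λ a b → toℕ a < toℕ b × toℕ (lookup u a) < toℕ (lookup u b) × swapAt i j u ≡ swapAt a b u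
step-ascent u i j inv< with ℕ.<-cmp (toℕ i) (toℕ j)
... | tri≈ _ i≡j _ = contradiction (cong inv (sym (swapAt-cong u (cong (lookup u) (Fin.toℕ-injective i≡j))))) (ℕ.<⇒≢ inv<)
... | tri< i<j _ _ = i , j , i<j , swapAt-ascent u i<j inv< , refl
... | tri> _ _ j<i = j , i , j<i , swapAt-ascent u j<i (subst (λ v → inv u < inv v) comm inv<) , comm
  where
  comm = sym (swapAt-comm u (<⇒≢ j<i))

≤B-trans : ∀ {n} {u v w : Word n} → u ≤B v → v ≤B w → u ≤B w
≤B-trans ≤B-refl               v≤w = v≤w
≤B-trans (≤B-step i j lt u′≤v) v≤w = ≤B-step i j lt (≤B-trans u′≤v v≤w)

Distinct-swapAt : ∀ {n} (u : Word n) {i j} → i ≢ j → Distinct u → Distinct (swapAt i j u)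
Distinct-swapAt u {i} {j} i≢j inj a b eq = transposed-unique i≢j
  (transposed-sym (transposed i j a))
  (subst (λ c → Transposed i j c b) (sym σa≡σb) (transposed-sym (transposed i j b)))
  where
  σa≡σb : PC.transpose i j a ≡ PC.transpose i j b
  σa≡σb = inj _ _ (trans (sym (lookup-swapAt u i≢j (transposed i j a))) (trans eq (lookup-swapAt u i≢j (transposed i j b))))

-- Words may repeat entries; that the members of the interval are permutations is inherited from
-- `idP` along the steps.
Distinct-≤B : ∀ {n} {u v : Word n} → Distinct u → u ≤B v → Distinct v
Distinct-≤B inj ≤B-refl = inj
Distinct-≤B {u = u} inj (≤B-step i j lt u′≤v) with a , b , a<b , _ , eq ← step-ascent u i j lt =
  Distinct-≤B (subst Distinct (sym eq) (Distinct-swapAt u (<⇒≢ a<b) inj)) u′≤v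

Distinct-idP : ∀ n → Distinct (idP n)
Distinct-idP n i j eq = trans (sym (Vec.lookup-allFin i)) (trans eq (Vec.lookup-allFin j))

-- Pigeonhole: removing a missed value would inject `Fin (suc n)` into `Fin n`.
Distinct-surjective : ∀ {n} (v : Word n) → Distinct v → ∀ y → ∃ λ q → lookup v q ≡ y
Distinct-surjective {suc n} v inj y with Fin.any? (λ q → lookup v q Fin.≟ y)
... | yes hit = hit
... | no miss = contradiction (Fin.injective⇒≤ {f = f} (λ {a} {b} → injective a b)) ℕ.1+n≰n
  where
  avoids : ∀ a → y ≢ lookup v a
  avoids a eq = miss (a , sym eq)
  f : Fin (suc n) → Fin n
  f a = punchOut (avoids a)
  injective : ∀ a b → f a ≡ f b → a ≡ b
  injective a b eq = inj a b (Fin.punchOut-injective (avoids a) (avoids b) eq)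

smallest-failure : ∀ {n} {P : Fin n → Set} → (∀ i → Dec (P i)) →
  (∀ i → P i) ⊎ ∃ λ i → ¬ P i × ∀ j → toℕ j < toℕ i → P j
smallest-failure {zero}  P? = inj₁ λ ()
smallest-failure {suc n} P? with P? zero
... | no ¬p = inj₂ (zero , ¬p , λ _ ())
... | yes p with smallest-failure (P? ∘ suc)
...   | inj₁ all = inj₁ λ { zero → p ; (suc i) → all i }
...   | inj₂ (i , ¬pi , below) = inj₂ (suc i , ¬pi , λ { zero _ → p ; (suc j) (s≤s lt) → below j lt })

largest-failure : ∀ {n} {P : Fin n → Set} → (∀ i → Dec (P i)) →
  (∀ i → P i) ⊎ ∃ λ i → ¬ P i × ∀ j → toℕ i < toℕ j → P j
largest-failure {zero}  P? = inj₁ λ ()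
largest-failure {suc n} P? with largest-failure (P? ∘ suc)
... | inj₂ (i , ¬pi , above) = inj₂ (suc i , ¬pi , λ { (suc j) (s≤s lt) → above j lt })
... | inj₁ all with P? zero
...   | yes p = inj₁ λ { zero → p ; (suc i) → all i }
...   | no ¬p = inj₂ (zero , ¬p , λ { (suc j) _ → all j })

-- Let `p` be the first position that is not fixed. All smaller values sit at their own places, so
-- the value `p` occurs at some later `q` and `v` exceeds `p` at `p`. Exchanging `p` and `q` removes
-- inversions, and the induction is on their number.
idP-minimum : ∀ {n} (v : Word n) → Distinct v → idP n ≤B v
idP-minimum {n} v inj = go v inj (<-wellFounded (inv v))
  where
  go : ∀ v → Distinct v → Acc _<_ (inv v) → idP n ≤B v
  go v inj (acc rec) with smallest-failure (λ p → lookup v p Fin.≟ p)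
  ... | inj₁ fixes = subst (idP n ≤B_) (lookup-ext (λ a → trans (Vec.lookup-allFin a) (sym (fixes a)))) ≤B-refl
  ... | inj₂ (p , vp≢p , below) with q , vq≡p ← Distinct-surjective v inj p = ≤B-trans
    (go v′ (Distinct-swapAt v (<⇒≢ p<q) inj) (rec descends))
    (≤B-step p q (subst (λ u → inv v′ < inv u) (sym back) descends) (subst (_≤B v) (sym back) ≤B-refl))
    where
    v′ = swapAt p q v
    p<q : toℕ p < toℕ q
    p<q with ℕ.<-cmp (toℕ p) (toℕ q)
    ... | tri< lt _ _ = lt
    ... | tri≈ _ eq _ = contradiction (trans (cong (lookup v) (Fin.toℕ-injective eq)) vq≡p) vp≢p
    ... | tri> _ _ gt = contradiction (cong toℕ (trans (sym vq≡p) (below q gt))) (ℕ.<⇒≢ gt ∘ sym)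
    p<vp : toℕ p < toℕ (lookup v p)
    p<vp with ℕ.<-cmp (toℕ p) (toℕ (lookup v p))
    ... | tri< lt _ _ = lt
    ... | tri≈ _ eq _ = contradiction (sym (Fin.toℕ-injective eq)) vp≢p
    ... | tri> _ _ gt = contradiction (inj (lookup v p) p (below (lookup v p) gt)) vp≢p
    descends : inv v′ < inv v
    descends = inv-swapAt-descent v p<q (subst (λ y → toℕ y < toℕ (lookup v p)) (sym vq≡p) p<vp)
    back : swapAt p q v′ ≡ v
    back = swapAt-involutive v (<⇒≢ p<q)

-- The interval below wmax

toℕ-wmax : ∀ n k (p : Fin n) .{{_ : ℕ.NonZero n}} → toℕ (lookup (wmax n k) p) ≡ (toℕ p + (n ∸ k)) % n
toℕ-wmax (suc n) k p = trans (cong toℕ (Vec.lookup∘tabulate (λ q → (toℕ q + (suc n ∸ k)) mod suc n) p)) (Fin.toℕ-fromℕ< _)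

module _ (k m : ℕ) where

  private
    n = k + m

  InBand : Word n → Set
  InBand v = ∀ p → Band k m p (lookup v p)

  toℕ-wmax-top : ∀ (p : Fin n) → toℕ p < k → toℕ (lookup (wmax n k) p) ≡ toℕ p + m
  toℕ-wmax-top p p<k = begin
    toℕ (lookup (wmax n k) p) ≡⟨ toℕ-wmax n k p ⟩
    (toℕ p + (n ∸ k)) % n     ≡⟨ cong (λ d → (toℕ p + d) % n) (ℕ.m+n∸m≡n k m) ⟩
    (toℕ p + m) % n           ≡⟨ m<n⇒m%n≡m (ℕ.+-monoˡ-< m p<k) ⟩
    toℕ p + m                 ∎
    where
    instance _ = Fin.nonZeroIndex p

  toℕ-wmax-bottom : ∀ (p : Fin n) → k ≤ toℕ p → toℕ (lookup (wmax n k) p) + k ≡ toℕ p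
  toℕ-wmax-bottom p k≤p = begin
    toℕ (lookup (wmax n k) p) + k         ≡⟨ cong (_+ k) (toℕ-wmax n k p) ⟩
    (toℕ p + (n ∸ k)) % n + k             ≡⟨ cong (λ d → (toℕ p + d) % n + k) (ℕ.m+n∸m≡n k m) ⟩
    (toℕ p + m) % n + k                   ≡⟨ cong (λ d → (d + m) % n + k) (ℕ.m∸n+n≡m k≤p) ⟨
    (toℕ p ∸ k + k + m) % n + k           ≡⟨ cong (λ d → d % n + k) (ℕ.+-assoc (toℕ p ∸ k) k m) ⟩
    (toℕ p ∸ k + n) % n + k               ≡⟨ cong (_+ k) ([m+n]%n≡m%n (toℕ p ∸ k) n) ⟩
    (toℕ p ∸ k) % n + k                   ≡⟨ cong (_+ k) (m<n⇒m%n≡m (ℕ.≤-<-trans (ℕ.m∸n≤m (toℕ p) k) (Fin.toℕ<n p))) ⟩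
    toℕ p ∸ k + k                         ≡⟨ ℕ.m∸n+n≡m k≤p ⟩
    toℕ p                                 ∎
    where
    instance _ = Fin.nonZeroIndex p

  InBand-wmax : InBand (wmax n k)
  InBand-wmax p with toℕ p ℕ.<? k
  ... | yes p<k = ℕ.≤-reflexive (toℕ-wmax-top p p<k) , ℕ.≤-trans (ℕ.<⇒≤ p<k) (ℕ.m≤n+m k _)
  ... | no  p≮k = ℕ.≤-trans (ℕ.m≤m+n _ k) (ℕ.≤-trans (ℕ.≤-reflexive eq) (ℕ.m≤m+n (toℕ p) m)) , ℕ.≤-reflexive (sym eq)
    where eq = toℕ-wmax-bottom p (ℕ.≮⇒≥ p≮k)

  -- Of the four band conditions at `i` and `j` after the exchange, the tight ones are u(j) ≤ i + m
  -- and j ≤ u(i) + k. Together with i < j and u(i) < u(j) they imply all four conditions before it.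
  InBand-step : ∀ u {i j} → toℕ i < toℕ j → toℕ (lookup u i) < toℕ (lookup u j) → InBand (swapAt i j u) → InBand u
  InBand-step u {i} {j} i<j ui<uj band a
    with bi₁ , bi₂ ← subst (Band k m i) (lookup-swapAt u (<⇒≢ i<j) left) (band i)
       | bj₁ , bj₂ ← subst (Band k m j) (lookup-swapAt u (<⇒≢ i<j) right) (band j)
    with PC.transpose i j a | transposed i j a
  ... | _ | left  = ℕ.<⇒≤ (ℕ.<-≤-trans ui<uj bi₁) , ℕ.<⇒≤ (ℕ.<-≤-trans i<j bj₂)
  ... | _ | right = ℕ.≤-trans bi₁ (ℕ.+-monoˡ-≤ m (ℕ.<⇒≤ i<j)) , ℕ.≤-trans bj₂ (ℕ.+-monoˡ-≤ k (ℕ.<⇒≤ ui<uj))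
  ... | _ | fixed a≢i a≢j = subst (Band k m a) (lookup-swapAt u (<⇒≢ i<j) (fixed a≢i a≢j)) (band a)

  InBand-≤B : ∀ {u v} → u ≤B v → InBand v → InBand u
  InBand-≤B ≤B-refl band = band
  InBand-≤B {u} (≤B-step i j lt u′≤v) band with a , b , a<b , ua<ub , eq ← step-ascent u i j lt =
    InBand-step u a<b ua<ub (subst InBand eq (InBand-≤B u′≤v band))

  InBand-swapAt : ∀ v {i j} → InBand v → toℕ i < toℕ j → toℕ (lookup v i) < toℕ (lookup v j) →
    toℕ (lookup v j) ≤ toℕ i + m → toℕ j ≤ toℕ (lookup v i) + k → InBand (swapAt i j v)
  InBand-swapAt v {i} {j} band i<j vi<vj vj≤ j≤ a with PC.transpose i j a | transposed i j a
  ... | _ | left = subst (Band k m i) (sym (lookup-swapAt v (<⇒≢ i<j) left))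
    (vj≤ , ℕ.≤-trans (ℕ.<⇒≤ i<j) (proj₂ (band j)))
  ... | _ | right = subst (Band k m j) (sym (lookup-swapAt v (<⇒≢ i<j) right))
    (ℕ.≤-trans (ℕ.<⇒≤ vi<vj) (proj₁ (band j)) , j≤)
  ... | _ | fixed a≢i a≢j = subst (Band k m a) (sym (lookup-swapAt v (<⇒≢ i<j) (fixed a≢i a≢j))) (band a)

  TopMaximal : Word n → Fin n → Set
  TopMaximal v p = toℕ p < k → toℕ (lookup v p) ≡ toℕ p + m

  -- Once the first `k` positions carry the values from `m` on, the rest are forced to be
  -- increasing. At the last position `p` violating this, the band gives p < v(p) + k, and the value
  -- v(p) turns out to occur elsewhere too.
  topMaximal⇒wmax : ∀ v → Distinct v → InBand v → (∀ p → TopMaximal v p) → v ≡ wmax n k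
  topMaximal⇒wmax v inj band tops with largest-failure (λ p → (k ℕ.≤? toℕ p) →-dec (toℕ (lookup v p) + k ℕ.≟ toℕ p))
  ... | inj₁ bottoms = lookup-ext (Fin.toℕ-injective ∘ agree)
    where
    agree : ∀ p → toℕ (lookup v p) ≡ toℕ (lookup (wmax n k) p)
    agree p with toℕ p ℕ.<? k
    ... | yes p<k = trans (tops p p<k) (sym (toℕ-wmax-top p p<k))
    ... | no  p≮k = ℕ.+-cancelʳ-≡ k _ _ (trans (bottoms p (ℕ.≮⇒≥ p≮k)) (sym (toℕ-wmax-bottom p (ℕ.≮⇒≥ p≮k))))
  ... | inj₂ (p , fails , above) with k ℕ.≤? toℕ p
  ...   | no k≰p = contradiction (λ k≤p → contradiction k≤p k≰p) fails
  ...   | yes k≤p with toℕ (lookup v p) ℕ.<? m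
  -- Position v(p) + k exists and lies beyond `p`, so by the choice of `p` it already carries the
  -- value v(p).
  ...     | yes vp<m = contradiction (ℕ.<⇒≢ p<q) (λ ≢ → ≢ (cong toℕ p≡q))
    where
    q<n : toℕ (lookup v p) + k < n
    q<n = subst (toℕ (lookup v p) + k <_) (ℕ.+-comm m k) (ℕ.+-monoˡ-< k vp<m)
    q : Fin n
    q = fromℕ< q<n
    toℕ-q : toℕ q ≡ toℕ (lookup v p) + k
    toℕ-q = Fin.toℕ-fromℕ< q<n
    p<q : toℕ p < toℕ q
    p<q = subst (toℕ p <_) (sym toℕ-q) (ℕ.≤∧≢⇒< (proj₂ (band p)) (λ eq → fails (λ _ → sym eq)))
    p≡q : p ≡ q
    p≡q = inj p q (Fin.toℕ-injective (ℕ.+-cancelʳ-≡ k _ _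
      (trans (sym toℕ-q) (sym (above q p<q (ℕ.≤-trans k≤p (ℕ.<⇒≤ p<q)))))))
  -- The value v(p) is at least `m`, hence already taken by the top position v(p) - m.
  ...     | no vp≮m = contradiction (ℕ.<-≤-trans s<k k≤p) (λ lt → ℕ.<⇒≢ lt (trans (sym toℕ-q) (cong toℕ q≡p)))
    where
    s = toℕ (lookup v p) ∸ m
    s+m : s + m ≡ toℕ (lookup v p)
    s+m = ℕ.m∸n+n≡m (ℕ.≮⇒≥ vp≮m)
    s<k : s < k
    s<k = ℕ.+-cancelʳ-< m s k (subst (_< n) (sym s+m) (Fin.toℕ<n (lookup v p)))
    q : Fin n
    q = fromℕ< (ℕ.<-≤-trans s<k (ℕ.m≤m+n k m))
    toℕ-q : toℕ q ≡ s
    toℕ-q = Fin.toℕ-fromℕ< _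
    q≡p : q ≡ p
    q≡p = inj q p (Fin.toℕ-injective (trans (tops q (subst (_< k) (sym toℕ-q) s<k)) (trans (cong (_+ m) toℕ-q) s+m)))

  -- For the largest p < k with v(p) < p + m, exchange p with position v(p) + k if there is one,
  -- and with the position of the value p + m otherwise.
  band-ascent : ∀ v → Distinct v → InBand v → ∀ p → ¬ TopMaximal v p → (∀ q → toℕ p < toℕ q → TopMaximal v q) →
    ∃ λ j → toℕ p < toℕ j × toℕ (lookup v p) < toℕ (lookup v j) ×
            toℕ (lookup v j) ≤ toℕ p + m × toℕ j ≤ toℕ (lookup v p) + k
  band-ascent v inj band p fails above with toℕ p ℕ.<? k
  ... | no  p≮k = contradiction (λ p<k → contradiction p<k p≮k) fails
  ... | yes p<k with toℕ (lookup v p) + k ℕ.<? n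
  ...   | yes j<n = j , p<j , vp<vj , vj≤ , ℕ.≤-reflexive toℕ-j
    where
    j : Fin n
    j = fromℕ< j<n
    toℕ-j : toℕ j ≡ toℕ (lookup v p) + k
    toℕ-j = Fin.toℕ-fromℕ< j<n
    k≤j : k ≤ toℕ j
    k≤j = subst (k ≤_) (sym toℕ-j) (ℕ.m≤n+m k (toℕ (lookup v p)))
    p<j : toℕ p < toℕ j
    p<j = ℕ.<-≤-trans p<k k≤j
    vp<vj : toℕ (lookup v p) < toℕ (lookup v j)
    -- The lower band condition at j = v(p) + k reads v(p) ≤ v(j).
    vp<vj = ℕ.≤∧≢⇒< (ℕ.+-cancelʳ-≤ k _ _ (subst (_≤ toℕ (lookup v j) + k) toℕ-j (proj₂ (band j))))
                     (λ eq → <⇒≢ p<j (inj p j (Fin.toℕ-injective eq)))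
    vj≤ : toℕ (lookup v j) ≤ toℕ p + m
    vj≤ with toℕ (lookup v j) ℕ.≤? toℕ p + m
    ... | yes le = le
    -- A value v(j) above p + m equals s + m for some s with p < s < k, and by the choice of `p` it
    -- belongs to position `s`, not to `j`.
    ... | no ≰ = contradiction (cong toℕ q≡j) (ℕ.<⇒≢ (ℕ.<-≤-trans (subst (_< k) (sym toℕ-q) s<k) k≤j))
      where
      p+m< : toℕ p + m < toℕ (lookup v j)
      p+m< = ℕ.≰⇒> ≰
      s = toℕ (lookup v j) ∸ m
      s+m : s + m ≡ toℕ (lookup v j)
      s+m = ℕ.m∸n+n≡m (ℕ.≤-trans (ℕ.m≤n+m m (toℕ p)) (ℕ.<⇒≤ p+m<))
      s<k : s < k
      s<k = ℕ.+-cancelʳ-< m s k (subst (_< n) (sym s+m) (Fin.toℕ<n (lookup v j)))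
      p<s : toℕ p < s
      p<s = ℕ.+-cancelʳ-< m (toℕ p) s (subst (toℕ p + m <_) (sym s+m) p+m<)
      q : Fin n
      q = fromℕ< (ℕ.<-≤-trans s<k (ℕ.m≤m+n k m))
      toℕ-q : toℕ q ≡ s
      toℕ-q = Fin.toℕ-fromℕ< _
      q≡j : q ≡ j
      q≡j = inj q j (Fin.toℕ-injective (trans
        (above q (subst (toℕ p <_) (sym toℕ-q) p<s) (subst (_< k) (sym toℕ-q) s<k))
        (trans (cong (_+ m) toℕ-q) s+m)))
  ...   | no j≮n with j , vj≡ ← Distinct-surjective v inj (fromℕ< (ℕ.+-monoˡ-< m p<k)) =
    -- Here v(p) + k is at least `n`, so the condition on `j` holds for every position.
    j , p<j , subst (toℕ (lookup v p) <_) (sym vj) vp< , ℕ.≤-reflexive vj ,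
    ℕ.≤-trans (ℕ.<⇒≤ (Fin.toℕ<n j)) (ℕ.≮⇒≥ j≮n)
    where
    vj : toℕ (lookup v j) ≡ toℕ p + m
    vj = trans (cong toℕ vj≡) (Fin.toℕ-fromℕ< _)
    vp< : toℕ (lookup v p) < toℕ p + m
    vp< = ℕ.≤∧≢⇒< (proj₁ (band p)) (λ eq → fails (λ _ → eq))
    p<j : toℕ p < toℕ j
    p<j = ℕ.≤∧≢⇒< (ℕ.+-cancelʳ-≤ m _ _ (subst (_≤ toℕ j + m) vj (proj₁ (band j))))
      (λ eq → ℕ.<⇒≢ vp< (trans (cong (toℕ ∘ lookup v) (Fin.toℕ-injective eq)) vj))

  -- Each exchange supplied by `band-ascent` stays in the band and raises `inv`, so the distance of
  -- `inv` to its ceiling decreases. When none is left, all top positions are maximal and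
  -- `topMaximal⇒wmax` applies.
  wmax-maximum : ∀ v → Distinct v → InBand v → v ≤B wmax n k
  wmax-maximum v inj band = go v inj band (<-wellFounded (bound ∸ inv v))
    where
    bound = n * (n * 1)
    go : ∀ v → Distinct v → InBand v → Acc _<_ (bound ∸ inv v) → v ≤B wmax n k
    go v inj band (acc rec) with largest-failure (λ p → (toℕ p ℕ.<? k) →-dec (toℕ (lookup v p) ℕ.≟ toℕ p + m))
    ... | inj₁ tops = subst (v ≤B_) (topMaximal⇒wmax v inj band tops) ≤B-refl
    ... | inj₂ (p , fails , above) with j , p<j , vp<vj , vj≤ , j≤ ← band-ascent v inj band p fails above =
      ≤B-step p j ascends (go (swapAt p j v) (Distinct-swapAt v (<⇒≢ p<j) inj)
        (InBand-swapAt v band p<j vp<vj vj≤ j≤) (rec (ℕ.∸-monoʳ-< ascends (inv-bounded (swapAt p j v)))))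
      where
      ascends : inv v < inv (swapAt p j v)
      ascends = inv-swapAt v p<j vp<vj

  Interval⇔band : ∀ v → (Distinct v × InBand v) ⇔ Interval (idP n) (wmax n k) v
  Interval⇔band v = mk⇔
    (λ (inj , band) → idP-minimum v inj , wmax-maximum v inj band)
    (λ (id≤v , v≤w) → Distinct-≤B (Distinct-idP n) id≤v , InBand-≤B v≤w InBand-wmax)

HasCard-cong : ∀ {A : Set} {P Q : A → Set} {N} → (∀ v → P v ⇔ Q v) → HasCard P N → HasCard Q N
HasCard-cong P⇔Q (L , unique , mem , len) = L , unique , (λ v → mk⇔
  (Equivalence.to (P⇔Q v) ∘ Equivalence.to (mem v))
  (Equivalence.from (mem v) ∘ Equivalence.from (P⇔Q v))) , len

card-Interval : ∀ n k m → k + m ≡ n → HasCard (Interval (idP n) (wmax n k)) (stirlingSum k m)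
card-Interval n k m refl = HasCard-cong (Interval⇔band k m) (card-band k m)

theorem3p5 : (n k : ℕ) → 1 ≤ k → k ≤ n ∸ 1 →
    let N = sumℕ k (λ i → S (k + 1) (i + 1) * S (n ∸ k + 1) (i + 1) * (i ! * i !)) in
    HasCard (Interval (idP n) (wmax n k)) N
    × (+ N ≡ sign k ℤ.* sumℤ k (λ i → sign i ℤ.* + ((i + 1) ^ (n ∸ k) * i ! * S k i)))
    × (ℚfromℕ N ≡ polyBernoulli k (+ k ℤ.- + n))
theorem3p5 n@(suc n-1) k 1≤k k≤n-1 =
    card-Interval n k (n ∸ k) (ℕ.m+[n∸m]≡n k≤n)
  , stirlingSum-alternating k (n ∸ k)
  -- The bound k ≤ n - 1 makes `n ∸ k` a successor, hence `k − n` a strictly negative index, where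
  -- `invPow` is an ordinary power.
  , subst₂ (λ m j → ℚfromℕ (stirlingSum k m) ≡ polyBernoulli k j) (sym n∸k) (sym k-n) (polyBernoulli-stirlingSum k (n-1 ∸ k))
  where
  k≤n : k ≤ n
  k≤n = ℕ.m≤n⇒m≤1+n k≤n-1
  n∸k : n ∸ k ≡ suc (n-1 ∸ k)
  n∸k = ℕ.+-∸-assoc 1 k≤n-1
  k-n : + k ℤ.- + n ≡ -[1+ n-1 ∸ k ]
  k-n = trans (ℤ.m-n≡m⊖n k n) (trans (ℤ.⊖-< (s≤s k≤n-1)) (cong (λ d → ℤ.- + d) n∸k))
theorem3p5 zero (suc _) _ ()
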